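{- Let $m\ge 0$, $r\ge 1$ be integers, let $G$ be a connected graph with exactly $m$ edges and maximum degree at most $r$, and let $T$ be a cluster of $G$ with $e(B_T)<e(R_T)\le r$. Let $G'_T$ be the colex folding of $G$ at $T$. Then $G'_T$ has exactly $m$ edges and maximum degree at most $r$, and $k_t(G'_T)\ge k_t(G)$ for every $t\ge 2$.
   Context: All graphs are finite and simple; $e(H)$ is the number of edges of $H$ and $k_t(H)$ the number of cliques on exactly $t$ vertices. For a graph $G$ of maximum degree at most $r$, a nonempty clique $T$ is tight if the set $N(T)$ of common neighbours of all vertices of $T$ has size $r+1-|T|$; a cluster is an inclusion-maximal tight clique. For a cluster $T$: $S_T=N(T)$; $R_T$ is the complement of $G[S_T]$, i.e. the graph on $S_T$ whose edges are the pairs of $S_T$ not adjacent in $G$; $B_T$ is the graph of all edges $uv$ of $G$ with $u\in S_T$, $v\in V(G)\setminus(T\cup S_T)$. The colex graph $\mathcal{C}(n)$ is the graph on the positive integers whose edges are the first $n$ pairs $\{i<j\}$ in the order where $\{i<j\}$ precedes $\{i'<j'\}$ iff $j<j'$ or ($j=j'$ and $i<i'$). The colex folding of $G$ at $T$ is $G'_T=G[V(G)\setminus(T\cup S_T)]\cup \mathcal{C}\bigl(\binom{r+1}{2}-e(R_T)+e(B_T)\bigr)$ (disjoint union). -}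

module Defs where

open import Data.Bool using (Bool; true; false; _∧_; _∨_; not; if_then_else_)
open import Data.Nat using (ℕ; zero; suc; _+_; _∸_; _≤_; _<_; _<ᵇ_; _≡ᵇ_)
open import Data.Nat.Combinatorics using (_C_)
open import Data.Fin using (Fin; zero; suc; toℕ; splitAt; _↑ˡ_; _↑ʳ_)
open import Data.Fin.Properties using (_≟_)
open import Data.Sum using (_⊎_; inj₁; inj₂)
open import Data.Product using (_×_)
open import Relation.Nullary.Decidable using (⌊_⌋)
open import Relation.Binary.PropositionalEquality using (_≡_; _≢_; refl)

record Graph : Set where
  field
    n      : ℕ
    adj    : Fin n → Fin n → Bool
    sym    : ∀ i j → adj i j ≡ adj j i
    irrefl : ∀ i → adj i i ≡ false
open Graph public

Subset : ℕ → Set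
Subset n = Fin n → Bool

count : {n : ℕ} → (Fin n → Bool) → ℕ
count {zero}  p = 0
count {suc n} p = (if p zero then 1 else 0) + count (λ i → p (suc i))

count2 : {n : ℕ} → (Fin n → Fin n → Bool) → ℕ
count2 f = sumFin (λ i → count (f i))
  where
  sumFin : {m : ℕ} → (Fin m → ℕ) → ℕ
  sumFin {zero}  h = 0
  sumFin {suc m} h = h zero + sumFin (λ i → h (suc i))

allFin : {n : ℕ} → (Fin n → Bool) → Bool
allFin {zero}  p = true
allFin {suc n} p = p zero ∧ allFin (λ i → p (suc i))

cons : {n : ℕ} → Bool → Subset n → Subset (suc n)
cons b q zero    = b
cons b q (suc i) = q i

countSubsets : {n : ℕ} → (Subset n → Bool) → ℕ
countSubsets {zero}  P = if P (λ ()) then 1 else 0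
countSubsets {suc n} P = countSubsets (λ q → P (cons true q)) + countSubsets (λ q → P (cons false q))

countBelow : ℕ → (ℕ → Bool) → ℕ
countBelow zero    p = 0
countBelow (suc N) p = countBelow N p + (if p N then 1 else 0)

sumBelow : ℕ → (ℕ → ℕ) → ℕ
sumBelow zero    h = 0
sumBelow (suc N) h = sumBelow N h + h N

edges : Graph → ℕ
edges G = count2 (λ i j → (toℕ i <ᵇ toℕ j) ∧ adj G i j)

degree : (G : Graph) → Fin (n G) → ℕ
degree G v = count (adj G v)

MaxDegLe : Graph → ℕ → Set
MaxDegLe G r = ∀ v → degree G v ≤ r

isCliqueᵇ : (G : Graph) → Subset (n G) → Bool
isCliqueᵇ G p = allFin (λ i → allFin (λ j →
  not (p i ∧ p j ∧ not ⌊ i ≟ j ⌋) ∨ adj G i j))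

cliques : ℕ → Graph → ℕ
cliques t G = countSubsets (λ p → (count p ≡ᵇ t) ∧ isCliqueᵇ G p)

data Reach (G : Graph) : Fin (n G) → Fin (n G) → Set where
  here : ∀ {u} → Reach G u u
  step : ∀ {u w v} → adj G u w ≡ true → Reach G w v → Reach G u v

Connected : Graph → Set
Connected G = ∀ u v → Reach G u v

IsClique : (G : Graph) → Subset (n G) → Set
IsClique G T = ∀ i j → T i ≡ true → T j ≡ true → i ≢ j → adj G i j ≡ true

commonNbhd : (G : Graph) → Subset (n G) → Subset (n G)
commonNbhd G T v = allFin (λ u → not (T u) ∨ adj G u v)

Tight : (G : Graph) → ℕ → Subset (n G) → Set
Tight G r T = IsClique G T × 1 ≤ count T × (count (commonNbhd G T) + count T ≡ suc r)

Cluster : (G : Graph) → ℕ → Subset (n G) → Set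
Cluster G r T = Tight G r T ×
  (∀ T' → Tight G r T' → (∀ v → T v ≡ true → T' v ≡ true) → ∀ v → T' v ≡ T v)

S : (G : Graph) → Subset (n G) → Subset (n G)
S G T = commonNbhd G T

Rest : (G : Graph) → Subset (n G) → Subset (n G)
Rest G T v = not (T v ∨ S G T v)

eR : (G : Graph) → Subset (n G) → ℕ
eR G T = count2 (λ i j → (toℕ i <ᵇ toℕ j) ∧ S G T i ∧ S G T j ∧ not (adj G i j))

eB : (G : Graph) → Subset (n G) → ℕ
eB G T = count2 (λ u v → S G T u ∧ Rest G T v ∧ adj G u v)

enum : {n : ℕ} (p : Subset n) → Fin (count p) → Fin n
enum {suc n} p i with p zero
enum {suc n} p zero    | true  = zero
enum {suc n} p (suc i) | true  = suc (enum (λ k → p (suc k)) i)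
enum {suc n} p i       | false = suc (enum (λ k → p (suc k)) i)

induced : (G : Graph) → Subset (n G) → Graph
induced G p = record
  { n      = count p
  ; adj    = λ i j → adj G (enum p i) (enum p j)
  ; sym    = λ i j → sym G (enum p i) (enum p j)
  ; irrefl = λ i → irrefl G (enum p i)
  }

unionAdj : {a b : ℕ} → (Fin a → Fin a → Bool) → (Fin b → Fin b → Bool) →
           Fin (a + b) → Fin (a + b) → Bool
unionAdj {a} f g i j with splitAt a i | splitAt a j
... | inj₁ x | inj₁ y = f x y
... | inj₂ x | inj₂ y = g x y
... | inj₁ _ | inj₂ _ = false
... | inj₂ _ | inj₁ _ = false

_⊕_ : Graph → Graph → Graph
G ⊕ H = record
  { n      = n G + n H
  ; adj    = unionAdj (adj G) (adj H)
  ; sym    = symU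
  ; irrefl = irrU
  }
  where
  symU : ∀ i j → unionAdj (adj G) (adj H) i j ≡ unionAdj (adj G) (adj H) j i
  symU i j with splitAt (n G) i | splitAt (n G) j
  ... | inj₁ x | inj₁ y = sym G x y
  ... | inj₂ x | inj₂ y = sym H x y
  ... | inj₁ _ | inj₂ _ = refl
  ... | inj₂ _ | inj₁ _ = refl
  irrU : ∀ i → unionAdj (adj G) (adj H) i i ≡ false
  irrU i with splitAt (n G) i
  ... | inj₁ x = irrefl G x
  ... | inj₂ x = irrefl H x

-- The colex graph C(N)
-- 0-indexed: vertex a ∈ ℕ stands for the positive integer a + 1.

precedes : ℕ → ℕ → ℕ → ℕ → Bool
precedes a' b' a b = (b' <ᵇ b) ∨ ((b' ≡ᵇ b) ∧ (a' <ᵇ a))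

-- number of pairs {a' < b'} preceding {a < b} in colex order
-- (all of them have b' ≤ b, so it suffices to range over b' < b + 1)
colexRank : ℕ → ℕ → ℕ
colexRank a b = sumBelow (suc b) (λ b' → countBelow b' (λ a' → precedes a' b' a b))

colexEdgeℕ : ℕ → ℕ → ℕ → Bool
colexEdgeℕ N a b = (a <ᵇ b) ∧ (colexRank a b <ᵇ N)

colexAdjℕ : ℕ → ℕ → ℕ → Bool
colexAdjℕ N a b = colexEdgeℕ N a b ∨ colexEdgeℕ N b a

colexOn : ℕ → ℕ → Graph
colexOn N k = record
  { n      = k
  ; adj    = λ i j → colexAdjℕ N (toℕ i) (toℕ j)
  ; sym    = λ i j → orComm (colexEdgeℕ N (toℕ i) (toℕ j)) (colexEdgeℕ N (toℕ j) (toℕ i))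
  ; irrefl = λ i → irr (toℕ i)
  }
  where
  orComm : ∀ x y → (x ∨ y) ≡ (y ∨ x)
  orComm false false = refl
  orComm false true  = refl
  orComm true  false = refl
  orComm true  true  = refl
  ltIrr : ∀ a → (a <ᵇ a) ≡ false
  ltIrr zero = refl
  ltIrr (suc a) = ltIrr a
  irr : ∀ a → colexAdjℕ N a a ≡ false
  irr a rewrite ltIrr a = refl

-- C(N): all edges of C(N) lie within {1, …, N+1}; the remaining
-- (isolated) positive integers are omitted.
colex : ℕ → Graph
colex N = colexOn N (suc N)

fold : (G : Graph) → ℕ → Subset (n G) → Graph
fold G r T = induced G (Rest G T) ⊕ colex ((suc r C 2) ∸ eR G T + eB G T)

{-# OPTIONS --safe #-}
module Submission where

-- Put W = T ∪ S, so |W| = r + 1, and let q = e(R), b = e(B) and r = q + x.  The vertices of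
-- T have all their neighbours in W, so e(G) = e(G[Rest]) + b + (C(r+1,2) − q), and every clique
-- of G lies in Rest, lies in W, or contains an edge of B.
--   * Inside W: listing the edges of R as f₁, …, f_q, the t-sets that contain fᵢ₊₁ and avoid
--     one vertex outside fᵢ₊₁ of each of f₁, …, fᵢ number at least C(r−1−i, t−2); removing them
--     one edge after the other leaves at most C(r,t) + C(x,t−1) cliques.
--   * Through B: a common neighbour of the ends of an edge of B is itself joined to one of
--     them by an edge of B, so the i-th edge of B listed is the last one of at most
--     C(i−1, t−2) cliques, hence at most C(b,t−1) cliques in total.
-- The colex graph with C(r,2) + x + b edges has at least C(r,t) + C(x+b,t−1) cliques, and
-- C(x,t−1) + C(b,t−1) ≤ C(x+b,t−1) for t ≥ 2.

-- Both estimates on G must hold whatever the shapes of R and B are, and they are the values reached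
-- by stars. If R is a star with q edges, the r vertices of W other than its centre are pairwise
-- adjacent and the centre keeps x neighbours: C(r,t) + C(x,t-1) cliques. If B joins one vertex to b
-- pairwise adjacent vertices, C(b,t-1) cliques use B. For other shapes each edge of the list is
-- charged an amount that depends only on its position; by Pascal's rule these amounts telescope:
-- the C(r-1-i,t-2) with i < q add up to C(r,t-1) - C(x,t-1). The colex graph merges the two stars
-- into one. Since C(r+1,2) - q + b = C(r,2) + (x + b) and b ≤ q gives x + b ≤ r, it is, up to
-- isolated vertices, a complete graph on r vertices with one more vertex joined to x + b of them.
-- The same inequality keeps it within r + 1 vertices, whence the degree bound.

open import Defs
open import Data.Bool using (Bool; true; false; _∧_; _∨_; not; if_then_else_)
open import Data.Bool.ListAction using (all)
open import Data.Bool.Properties using (∧-conicalˡ; ∧-conicalʳ; ∧-zeroʳ; ∧-identityʳ; ∨-zeroʳ; not-injective) renaming (_≟_ to _≟ᵇ_)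
open import Data.Fin using (Fin; zero; suc; toℕ; fromℕ<; splitAt; _↑ˡ_; _↑ʳ_)
open import Data.Fin.Properties using (_≟_; toℕ-fromℕ<; toℕ-injective; toℕ<n; splitAt-↑ˡ; splitAt-↑ʳ; splitAt⁻¹-↑ˡ; splitAt⁻¹-↑ʳ; toℕ-↑ˡ; toℕ-↑ʳ)
open import Data.List as List using (List; []; _∷_; length; map; filter; cartesianProduct; tabulate)
open import Data.List.Membership.Propositional using (_∈_)
open import Data.List.Membership.Propositional.Properties using (∈-map⁺; ∈-filter⁺; ∈-filter⁻; ∈-cartesianProduct⁺; ∈-allFin)
open import Data.List.Properties using (filter-++; length-++; length-map)
open import Data.List.Relation.Unary.All as All using (All; []; _∷_)
open import Data.List.Relation.Unary.AllPairs using ([]; _∷_)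
open import Data.List.Relation.Unary.Any using (here; there)
open import Data.List.Relation.Unary.Unique.Propositional using (Unique)
import Data.List.Relation.Unary.Unique.Propositional.Properties as Unique
open import Data.Nat using (ℕ; zero; suc; _+_; _∸_; _⊓_; _≤_; _<_; _≤?_; _<ᵇ_; _≡ᵇ_; z≤n; s≤s; s≤s⁻¹)
open import Data.Nat.Combinatorics using (_C_; nCk+nC[k+1]≡[n+1]C[k+1]; nC1≡n)
open import Data.Nat.Properties hiding (_≟_; _≤?_)
open import Data.Product using (_×_; _,_; proj₁; proj₂; ∃-syntax)
open import Data.Sum using (_⊎_; inj₁; inj₂)
open import Function using (_∘_; id)
open import Relation.Binary.Definitions using (tri<; tri≈; tri>)
open import Relation.Binary.PropositionalEquality using (_≡_; _≢_; refl; cong; cong₂; trans; subst; module ≡-Reasoning) renaming (sym to ≡-sym)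
open import Relation.Nullary using (yes; no; contradiction)
open import Relation.Nullary.Decidable using (⌊_⌋)
open import Algebra.Properties.CommutativeMonoid.Sum +-0-commutativeMonoid using (sum; sum-cong-≗; ∑-distrib-+; ∑-comm; sum-replicate-zero)
open import Algebra.Properties.CommutativeSemigroup +-commutativeSemigroup using (interchange)

-- Booleans

ind : Bool → ℕ
ind b = if b then 1 else 0

∧-true : ∀ {a b} → a ≡ true → b ≡ true → a ∧ b ≡ true
∧-true refl refl = refl

≡true-or-false : ∀ b → (b ≡ true) ⊎ (b ≡ false)
≡true-or-false true  = inj₁ refl
≡true-or-false false = inj₂ refl

true≢false : ∀ {b} → b ≡ true → b ≡ false → ∀ {A : Set} → A
true≢false refl ()

not-true⇒false : ∀ {b} → not b ≡ true → b ≡ false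
not-true⇒false {false} _ = refl

⇒-true : ∀ {a b} → (a ≡ true → b ≡ true) → not a ∨ b ≡ true
⇒-true {false} h = refl
⇒-true {true}  h = h refl

⇒-elim : ∀ {a b} → not a ∨ b ≡ true → a ≡ true → b ≡ true
⇒-elim h refl = h

∨-cases : ∀ a {b} → a ∨ b ≡ true → (a ≡ true) ⊎ (b ≡ true)
∨-cases true  _ = inj₁ refl
∨-cases false h = inj₂ h

∧-falseʳ : ∀ {a b} → b ≡ false → a ∧ b ≡ false
∧-falseʳ {a} refl = ∧-zeroʳ a

bool-ext : ∀ {a b} → (a ≡ true → b ≡ true) → (b ≡ true → a ≡ true) → a ≡ b
bool-ext {false} {false} f g = refl
bool-ext {false} {true}  f g = g refl
bool-ext {true}          f g = ≡-sym (f refl)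

≡ᵇ-sound : ∀ a b → (a ≡ᵇ b) ≡ true → a ≡ b
≡ᵇ-sound zero    zero    _ = refl
≡ᵇ-sound (suc a) (suc b) h = cong suc (≡ᵇ-sound a b h)

≡ᵇ-refl : ∀ a → (a ≡ᵇ a) ≡ true
≡ᵇ-refl zero    = refl
≡ᵇ-refl (suc a) = ≡ᵇ-refl a

<ᵇ-sound : ∀ a b → (a <ᵇ b) ≡ true → a < b
<ᵇ-sound zero    (suc b) _ = s≤s z≤n
<ᵇ-sound (suc a) (suc b) h = s≤s (<ᵇ-sound a b h)

<ᵇ-complete : ∀ {a b} → a < b → (a <ᵇ b) ≡ true
<ᵇ-complete {zero}  (s≤s _)       = refl
<ᵇ-complete {suc a} (s≤s h@(s≤s _)) = <ᵇ-complete h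

≮ᵇ-complete : ∀ {a b} → b ≤ a → (a <ᵇ b) ≡ false
≮ᵇ-complete {a}     z≤n     = refl
≮ᵇ-complete {suc a} (s≤s h) = ≮ᵇ-complete h

≟-sound : ∀ {k} (i j : Fin k) → ⌊ i ≟ j ⌋ ≡ true → i ≡ j
≟-sound i j h with i ≟ j
... | yes e = e

≟-refl : ∀ {k} (i : Fin k) → ⌊ i ≟ i ⌋ ≡ true
≟-refl i with i ≟ i
... | yes _ = refl
... | no ne = contradiction refl ne

≟-≢ : ∀ {k} {i j : Fin k} → i ≢ j → ⌊ i ≟ j ⌋ ≡ false
≟-≢ {i = i} {j} ne with i ≟ j
... | yes e = contradiction e ne
... | no _ = refl

allFin-elim : ∀ {k} (p : Fin k → Bool) → allFin p ≡ true → ∀ i → p i ≡ true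
allFin-elim p h zero    = ∧-conicalˡ _ _ h
allFin-elim p h (suc i) = allFin-elim (p ∘ suc) (∧-conicalʳ (p zero) _ h) i

allFin-intro : ∀ {k} (p : Fin k → Bool) → (∀ i → p i ≡ true) → allFin p ≡ true
allFin-intro {zero}  p h = refl
allFin-intro {suc k} p h = ∧-true (h zero) (allFin-intro (p ∘ suc) (h ∘ suc))

allFin-cong : ∀ {k} {p q : Fin k → Bool} → (∀ i → p i ≡ q i) → allFin p ≡ allFin q
allFin-cong {zero}  h = refl
allFin-cong {suc k} h = cong₂ _∧_ (h zero) (allFin-cong (h ∘ suc))

allFin-false : ∀ {k} (p : Fin k → Bool) → allFin p ≡ false → ∃[ i ] p i ≡ false
allFin-false {suc k} p h with p zero in eq
... | false = zero , eq
... | true with allFin-false (p ∘ suc) h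
...   | i , e = suc i , e

-- Sums and counts over Fin

-- The left-hand side of sumFin≡sum is the summation local to count2, which has no name here:
-- unification fills it in from count2-false, whose sole purpose this is.
mutual
  sumFin≡sum : ∀ {m} (h : Fin m → ℕ) → _ ≡ sum h
  sumFin≡sum {zero}  h = refl
  sumFin≡sum {suc m} h = cong (h zero +_) (sumFin≡sum (h ∘ suc))

  count2-false : ∀ m → count2 {m} (λ _ _ → false) ≡ sum {m} (λ _ → count {m} (λ _ → false))
  count2-false m with (λ (i : Fin m) → count {m} (λ _ → false))
  ... | h = sumFin≡sum h

count≡sum : ∀ {k} (p : Fin k → Bool) → count p ≡ sum (ind ∘ p)
count≡sum {zero}  p = refl
count≡sum {suc k} p = cong (ind (p zero) +_) (count≡sum (p ∘ suc))

count2≡sum : ∀ {k} (f : Fin k → Fin k → Bool) → count2 f ≡ sum (λ i → sum (λ j → ind (f i j)))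
count2≡sum f = trans (sumFin≡sum (λ i → count (f i))) (sum-cong-≗ (λ i → count≡sum (f i)))

sum-mono : ∀ {k} {f g : Fin k → ℕ} → (∀ i → f i ≤ g i) → sum f ≤ sum g
sum-mono {zero}  h = z≤n
sum-mono {suc k} h = +-mono-≤ (h zero) (sum-mono (h ∘ suc))

ind-mono : ∀ {a b} → (a ≡ true → b ≡ true) → ind a ≤ ind b
ind-mono {false}         h = z≤n
ind-mono {true}  {true}  h = ≤-refl
ind-mono {true}  {false} h with () ← h refl

count-cong : ∀ {k} {p q : Fin k → Bool} → (∀ i → p i ≡ q i) → count p ≡ count q
count-cong {zero}  h = refl
count-cong {suc k} h = cong₂ (λ b c → ind b + c) (h zero) (count-cong (h ∘ suc))

count-mono : ∀ {k} {p q : Fin k → Bool} → (∀ i → p i ≡ true → q i ≡ true) → count p ≤ count q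
count-mono {zero}  h = z≤n
count-mono {suc k} h = +-mono-≤ (ind-mono (h zero)) (count-mono (h ∘ suc))

count-+ : ∀ {k} {p q s : Fin k → Bool} → (∀ i → ind (p i) ≡ ind (q i) + ind (s i)) →
          count p ≡ count q + count s
count-+ {p = p} {q} {s} h = begin
  count p                           ≡⟨ count≡sum p ⟩
  sum (ind ∘ p)                     ≡⟨ sum-cong-≗ h ⟩
  sum (λ i → ind (q i) + ind (s i)) ≡⟨ ∑-distrib-+ (ind ∘ q) (ind ∘ s) ⟩
  sum (ind ∘ q) + sum (ind ∘ s)     ≡⟨ cong₂ _+_ (count≡sum q) (count≡sum s) ⟨
  count q + count s                 ∎
  where open ≡-Reasoning

count-∪ : ∀ {k} (p q s : Fin k → Bool) → (∀ i → p i ≡ true → (q i ≡ true) ⊎ (s i ≡ true)) →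
          count p ≤ count q + count s
count-∪ p q s h = begin
  count p                           ≡⟨ count≡sum p ⟩
  sum (ind ∘ p)                     ≤⟨ sum-mono pointwise ⟩
  sum (λ i → ind (q i) + ind (s i)) ≡⟨ ∑-distrib-+ (ind ∘ q) (ind ∘ s) ⟩
  sum (ind ∘ q) + sum (ind ∘ s)     ≡⟨ cong₂ _+_ (count≡sum q) (count≡sum s) ⟨
  count q + count s                 ∎
  where
  open ≤-Reasoning
  pointwise : ∀ i → ind (p i) ≤ ind (q i) + ind (s i)
  pointwise i with p i | h i
  ... | false | _ = z≤n
  ... | true  | c with c refl
  ...   | inj₁ e = ≤-trans (≤-reflexive (cong ind (≡-sym e))) (m≤m+n _ _)
  ...   | inj₂ e = ≤-trans (≤-reflexive (cong ind (≡-sym e))) (m≤n+m _ _)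

_⊆_ : ∀ {k} → Subset k → Subset k → Set
p ⊆ q = ∀ i → p i ≡ true → q i ≡ true

count-disjoint : ∀ {k} {p q s : Subset k} → p ⊆ s → q ⊆ s → (∀ i → q i ≡ true → p i ≡ false) →
                 count p + count q ≤ count s
count-disjoint {p = p} {q} {s} ps qs pq = begin
  count p + count q             ≡⟨ cong₂ _+_ (count≡sum p) (count≡sum q) ⟩
  sum (ind ∘ p) + sum (ind ∘ q) ≡⟨ ∑-distrib-+ (ind ∘ p) (ind ∘ q) ⟨
  sum (λ i → ind (p i) + ind (q i)) ≤⟨ sum-mono pointwise ⟩
  sum (ind ∘ s)                 ≡⟨ count≡sum s ⟨
  count s                       ∎
  where
  open ≤-Reasoning
  pointwise : ∀ i → ind (p i) + ind (q i) ≤ ind (s i)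
  pointwise i with q i | qs i | pq i
  ... | true  | h | e rewrite e refl | h refl = ≤-refl
  ... | false | _ | _ = ≤-trans (≤-reflexive (+-identityʳ _)) (ind-mono (ps i))

count-empty : ∀ {k} (p : Fin k → Bool) → (∀ i → p i ≡ false) → count p ≡ 0
count-empty {zero}  p h = refl
count-empty {suc k} p h rewrite h zero = count-empty (p ∘ suc) (h ∘ suc)

⌊suc≟suc⌋ : ∀ {k} (i j : Fin k) → ⌊ suc i ≟ suc j ⌋ ≡ ⌊ i ≟ j ⌋
⌊suc≟suc⌋ i j with i ≟ j
... | yes _ = refl
... | no _ = refl

count-singleton : ∀ {k} (u : Fin k) → count (λ i → ⌊ i ≟ u ⌋) ≡ 1
count-singleton {suc k} zero    = cong suc (count-empty {k} _ (λ i → refl))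
count-singleton {suc k} (suc u) = trans (count-cong (λ i → ⌊suc≟suc⌋ i u)) (count-singleton u)

pair : ∀ {k} → Fin k → Fin k → Subset k
pair u v i = ⌊ i ≟ u ⌋ ∨ ⌊ i ≟ v ⌋

count-pair : ∀ {k} {u v : Fin k} → u ≢ v → count (pair u v) ≡ 2
count-pair {k} {u} {v} u≢v =
  trans (count-+ split) (cong₂ _+_ (count-singleton u) (count-singleton v))
  where
  split : ∀ i → ind (pair u v i) ≡ ind ⌊ i ≟ u ⌋ + ind ⌊ i ≟ v ⌋
  split i with i ≟ u | i ≟ v
  ... | yes refl | yes e = contradiction e u≢v
  ... | yes _    | no _  = refl
  ... | no _     | yes _ = refl
  ... | no _     | no _  = refl

count-below : ∀ {k c} → c ≤ k → count {k} (λ i → toℕ i <ᵇ c) ≡ c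
count-below {k} z≤n     = count-empty {k} _ (λ i → refl)
count-below     (s≤s h) = cong suc (count-below h)

count-below-≤ : ∀ k c → count {k} (λ i → toℕ i <ᵇ c) ≤ c
count-below-≤ zero    c       = z≤n
count-below-≤ (suc k) zero    = ≤-reflexive (count-empty {suc k} _ (λ _ → refl))
count-below-≤ (suc k) (suc c) = s≤s (count-below-≤ k c)

sum-++ : ∀ a {b} (h : Fin (a + b) → ℕ) → sum h ≡ sum (λ i → h (i ↑ˡ b)) + sum (λ j → h (a ↑ʳ j))
sum-++ zero    h = refl
sum-++ (suc a) h = trans (cong (h zero +_) (sum-++ a (h ∘ suc))) (≡-sym (+-assoc (h zero) _ _))

count-++ : ∀ a {b} (p : Fin (a + b) → Bool) → count p ≡ count (λ i → p (i ↑ˡ b)) + count (λ j → p (a ↑ʳ j))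
count-++ zero    p = refl
count-++ (suc a) p = trans (cong (ind (p zero) +_) (count-++ a (p ∘ suc))) (≡-sym (+-assoc (ind (p zero)) _ _))

sum-toℕ : ∀ k (h : ℕ → ℕ) → sum {k} (h ∘ toℕ) ≡ sumBelow k h
sum-toℕ zero    h = refl
sum-toℕ (suc k) h = trans (cong (h 0 +_) (sum-toℕ k (h ∘ suc))) (shift k)
  where
  -- `sum` splits off the first term, `sumBelow` the last one.
  shift : ∀ k → h 0 + sumBelow k (h ∘ suc) ≡ sumBelow k h + h k
  shift zero    = +-comm (h 0) 0
  shift (suc k) = trans (≡-sym (+-assoc (h 0) _ _)) (cong (_+ h (suc k)) (shift k))

count2-cong : ∀ {k} {f g : Fin k → Fin k → Bool} → (∀ i j → f i j ≡ g i j) → count2 f ≡ count2 g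
count2-cong {k} {f} {g} h = trans (count2≡sum f)
  (trans (sum-cong-≗ {k} (λ i → sum-cong-≗ {k} (λ j → cong ind (h i j)))) (≡-sym (count2≡sum g)))

count2-+ : ∀ {k} {f g h : Fin k → Fin k → Bool} → (∀ i j → ind (f i j) ≡ ind (g i j) + ind (h i j)) →
           count2 f ≡ count2 g + count2 h
count2-+ {k} {f} {g} {h} e = begin
  count2 f ≡⟨ count2≡sum f ⟩
  sum (λ i → sum (λ j → ind (f i j)))
    ≡⟨ sum-cong-≗ {k} (λ i → trans (sum-cong-≗ {k} (e i)) (∑-distrib-+ (ind ∘ g i) (ind ∘ h i))) ⟩
  sum (λ i → sum (ind ∘ g i) + sum (ind ∘ h i))
    ≡⟨ ∑-distrib-+ (λ i → sum (ind ∘ g i)) (λ i → sum (ind ∘ h i)) ⟩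
  sum (λ i → sum (ind ∘ g i)) + sum (λ i → sum (ind ∘ h i))
    ≡⟨ cong₂ _+_ (count2≡sum g) (count2≡sum h) ⟨
  count2 g + count2 h ∎
  where open ≡-Reasoning

count2-transpose : ∀ {k} (f : Fin k → Fin k → Bool) → count2 f ≡ count2 (λ i j → f j i)
count2-transpose f = trans (count2≡sum f) (trans (∑-comm (λ i j → ind (f i j))) (≡-sym (count2≡sum (λ i j → f j i))))

-- Subsets

subᵇ : ∀ {k} → Subset k → Subset k → Bool
subᵇ p q = allFin (λ i → not (p i) ∨ q i)

cs-cong : ∀ {k} {P Q : Subset k → Bool} → (∀ p → P p ≡ Q p) → countSubsets P ≡ countSubsets Q
cs-cong {zero}  h = cong ind (h (λ ()))
cs-cong {suc k} h = cong₂ _+_ (cs-cong (λ q → h (cons true q))) (cs-cong (λ q → h (cons false q)))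

cs-mono : ∀ {k} {P Q : Subset k → Bool} → (∀ p → P p ≡ true → Q p ≡ true) → countSubsets P ≤ countSubsets Q
cs-mono {zero}  h = ind-mono (h (λ ()))
cs-mono {suc k} h = +-mono-≤ (cs-mono (λ q → h (cons true q))) (cs-mono (λ q → h (cons false q)))

cs-+ : ∀ {k} {P Q R : Subset k → Bool} → (∀ p → ind (P p) ≡ ind (Q p) + ind (R p)) →
       countSubsets P ≡ countSubsets Q + countSubsets R
cs-+ {zero}  h = h (λ ())
cs-+ {suc k} {P} {Q} {R} h =
  trans (cong₂ _+_ (cs-+ (λ q → h (cons true q))) (cs-+ (λ q → h (cons false q))))
        (interchange (countSubsets (λ q → Q (cons true q))) (countSubsets (λ q → R (cons true q)))
                       (countSubsets (λ q → Q (cons false q))) (countSubsets (λ q → R (cons false q))))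

cs-split : ∀ {k} (P Q : Subset k → Bool) →
           countSubsets P ≡ countSubsets (λ p → P p ∧ Q p) + countSubsets (λ p → P p ∧ not (Q p))
cs-split P Q = cs-+ (λ p → split (P p) (Q p))
  where
  split : ∀ a b → ind a ≡ ind (a ∧ b) + ind (a ∧ not b)
  split false _     = refl
  split true  false = refl
  split true  true  = refl

cs-empty : ∀ {k} (P : Subset k → Bool) → (∀ p → P p ≡ false) → countSubsets P ≡ 0
cs-empty {zero}  P h = cong ind (h (λ ()))
cs-empty {suc k} P h = cong₂ _+_ (cs-empty _ (λ q → h (cons true q))) (cs-empty _ (λ q → h (cons false q)))

cs-disjoint : ∀ {k} {P Q R : Subset k → Bool} →
  (∀ p → Q p ≡ true → P p ≡ true) → (∀ p → R p ≡ true → P p ≡ true) →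
  (∀ p → R p ≡ true → Q p ≡ false) →
  countSubsets Q + countSubsets R ≤ countSubsets P
cs-disjoint {P = P} {Q} {R} qp rp qr = begin
  countSubsets Q + countSubsets R
    ≤⟨ +-mono-≤ (cs-mono (λ p q → ∧-true (qp p q) q)) (cs-mono (λ p r → ∧-true (rp p r) (cong not (qr p r)))) ⟩
  countSubsets (λ p → P p ∧ Q p) + countSubsets (λ p → P p ∧ not (Q p))
    ≡⟨ cs-split P Q ⟨
  countSubsets P ∎
  where
  open ≤-Reasoning

-- Binomial coefficients

pascal : ∀ n k → suc n C suc k ≡ n C k + n C suc k
pascal n k = ≡-sym (nCk+nC[k+1]≡[n+1]C[k+1] n k)

C-mono : ∀ {m n} k → m ≤ n → m C k ≤ n C k
C-mono zero    _   = ≤-refl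
C-mono (suc k) z≤n = z≤n
C-mono {suc m} {suc n} (suc k) (s≤s h) = begin
  suc m C suc k     ≡⟨ pascal m k ⟩
  m C k + m C suc k ≤⟨ +-mono-≤ (C-mono k h) (C-mono (suc k) h) ⟩
  n C k + n C suc k ≡⟨ pascal n k ⟨
  suc n C suc k     ∎
  where open ≤-Reasoning

-- In a disjoint union of an m-set and an n-set, the subsets of size `suc k` inside one part or the
-- other are distinct; for size 0 the empty set would be counted twice.
C-superadditive : ∀ m n k → m C suc k + n C suc k ≤ (m + n) C suc k
C-superadditive zero    n k = ≤-refl
C-superadditive (suc m) n k = begin
  suc m C suc k + n C suc k             ≡⟨ cong (_+ n C suc k) (pascal m k) ⟩
  m C k + m C suc k + n C suc k         ≡⟨ +-assoc (m C k) _ _ ⟩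
  m C k + (m C suc k + n C suc k)       ≤⟨ +-mono-≤ (C-mono k (m≤m+n m n)) (C-superadditive m n k) ⟩
  (m + n) C k + (m + n) C suc k         ≡⟨ pascal (m + n) k ⟨
  suc (m + n) C suc k                   ∎
  where open ≤-Reasoning

-- Intervals of the subset lattice

-- The interval from `A` to `A ∪ F`. Every binomial coefficient in the clique bounds arises as the
-- number of sets of one size in such an interval. `A` and `F` may overlap; membership in `A` then
-- prevails.
between : ∀ {k} → Subset k → Subset k → Subset k → Bool
between A F p = allFin (λ i → if A i then p i else (not (p i) ∨ F i))

between-elimˡ : ∀ {k} {A F p : Subset k} → between A F p ≡ true → A ⊆ p
between-elimˡ {A = A} {F} {p} h i a with A i | allFin-elim _ h i
... | true | e = e

between-elimʳ : ∀ {k} {A F p : Subset k} → between A F p ≡ true → ∀ i → p i ≡ true → (A i ≡ true) ⊎ (F i ≡ true)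
between-elimʳ {A = A} {F} {p} h i a with A i | allFin-elim _ h i
... | true  | e = inj₁ refl
... | false | e = inj₂ (⇒-elim e a)

between-intro : ∀ {k} {A F p : Subset k} → A ⊆ p → (∀ i → p i ≡ true → (A i ≡ true) ⊎ (F i ≡ true)) → between A F p ≡ true
between-intro {A = A} {F} {p} l r = allFin-intro _ go
  where
  go : ∀ i → (if A i then p i else (not (p i) ∨ F i)) ≡ true
  go i with A i | l i | r i
  ... | true  | li | ri = li refl
  ... | false | li | ri = ⇒-true λ pi → case (ri pi)
    where
    case : (false ≡ true) ⊎ (F i ≡ true) → F i ≡ true
    case (inj₂ f) = f

-- Each vertex is forced, forbidden or free, and a free one gives Pascal's rule. Writing the size as
-- `count A + s` makes `s` the number of free vertices to choose and avoids a subtraction.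
cs-between : ∀ {k} (A F : Subset k) s →
  countSubsets (λ p → (count p ≡ᵇ count A + s) ∧ between A F p) ≡ count (λ i → F i ∧ not (A i)) C s
cs-between {zero} A F zero    = refl
cs-between {zero} A F (suc s) = refl
cs-between {suc k} A F s with A zero | F zero
... | true  | b rewrite ∧-zeroʳ b =
  trans (cong₂ _+_ (cs-between (A ∘ suc) (F ∘ suc) s) (cs-empty {k} _ (λ p → ∧-zeroʳ _))) (+-identityʳ _)
... | false | false =
  cong₂ _+_ (cs-empty {k} _ (λ p → ∧-zeroʳ _)) (cs-between (A ∘ suc) (F ∘ suc) s)
... | false | true with s
-- With nothing left to choose, a set that takes this free vertex would have too few others to
-- contain `A ∘ suc`.
...   | zero = cong₂ _+_ (cs-empty _ tooSmall) (cs-between (A ∘ suc) (F ∘ suc) 0)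
  where
  tooSmall : ∀ q → (suc (count q) ≡ᵇ count (A ∘ suc) + 0) ∧ between (A ∘ suc) (F ∘ suc) q ≡ false
  tooSmall q with (suc (count q) ≡ᵇ count (A ∘ suc) + 0) in e | between (A ∘ suc) (F ∘ suc) q in b
  ... | false | _     = refl
  ... | true  | false = refl
  ... | true  | true  = contradiction
    (≤-trans (≤-reflexive (trans (≡ᵇ-sound _ _ e) (+-identityʳ _))) (count-mono (between-elimˡ {A = A ∘ suc} {F ∘ suc} {q} b)))
    (<-irrefl refl)
...   | suc s′ = begin
  countSubsets (λ q → (suc (count q) ≡ᵇ count A′ + suc s′) ∧ between A′ F′ q)
    + countSubsets (λ q → (count q ≡ᵇ count A′ + suc s′) ∧ between A′ F′ q)
    ≡⟨ cong₂ _+_ (trans (cs-cong λ q → cong (λ z → (suc (count q) ≡ᵇ z) ∧ between A′ F′ q) (+-suc (count A′) s′))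
                        (cs-between A′ F′ s′))
                 (cs-between A′ F′ (suc s′)) ⟩
  f C s′ + f C suc s′ ≡⟨ pascal f s′ ⟨
  suc f C suc s′ ∎
  where
  open ≡-Reasoning
  A′ F′ : Subset k
  A′ = A ∘ suc
  F′ = F ∘ suc
  f : ℕ
  f = count (λ i → F′ i ∧ not (A′ i))

-- The size of `A` is usually known only up to a proof, such as `count-pair`, so it enters through
-- an equation.
cs-between′ : ∀ {k} (A F : Subset k) {a s t} → count A ≡ a → a + s ≡ t →
  countSubsets (λ p → (count p ≡ᵇ t) ∧ between A F p) ≡ count (λ i → F i ∧ not (A i)) C s
cs-between′ A F {s = s} refl refl = cs-between A F s

-- Lists of vertices and of pairs

member : ∀ {k} → List (Fin k) → Subset k
member []       i = false
member (x ∷ xs) i = ⌊ i ≟ x ⌋ ∨ member xs i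

member-complete : ∀ {k} {xs : List (Fin k)} {i} → i ∈ xs → member xs i ≡ true
member-complete {i = i} (here refl) rewrite ≟-refl i = refl
member-complete {xs = x ∷ xs} {i} (there m) with ⌊ i ≟ x ⌋
... | true  = refl
... | false = member-complete m

count-member : ∀ {k} (xs : List (Fin k)) → count (member xs) ≤ length xs
count-member {k} [] = ≤-reflexive (count-empty {k} _ (λ _ → refl))
count-member (x ∷ xs) = ≤-trans
  (count-∪ _ _ (member xs) (λ i → ∨-cases ⌊ i ≟ x ⌋))
  (+-mono-≤ (≤-reflexive (count-singleton x)) (count-member xs))

-- The inductions over the edges of R and of B treat one edge at a time and therefore need a list,
-- while `eR` and `eB` are double counts; `length-pairs` connects the two.
pairs : ∀ {k} → (Fin k → Fin k → Bool) → List (Fin k × Fin k)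
pairs {k} f = filter (λ (i , j) → f i j ≟ᵇ true) (cartesianProduct (List.allFin k) (List.allFin k))

pairs-unique : ∀ {k} (f : Fin k → Fin k → Bool) → Unique (pairs f)
pairs-unique {k} f = Unique.filter⁺ _ (Unique.cartesianProduct⁺ (Unique.allFin⁺ k) (Unique.allFin⁺ k))

pairs-complete : ∀ {k} (f : Fin k → Fin k → Bool) {i j} → f i j ≡ true → (i , j) ∈ pairs f
pairs-complete f h = ∈-filter⁺ _ (∈-cartesianProduct⁺ (∈-allFin _) (∈-allFin _)) h

pairs-sound : ∀ {k} (f : Fin k → Fin k → Bool) → All (λ (i , j) → f i j ≡ true) (pairs f)
pairs-sound {k} f = All.tabulate λ m → proj₂
  (∈-filter⁻ (λ (i , j) → f i j ≟ᵇ true) {xs = cartesianProduct (List.allFin k) (List.allFin k)} m)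

length-pairs : ∀ {k} (f : Fin k → Fin k → Bool) → length (pairs f) ≡ count2 f
length-pairs {k} f = trans (rows id) (≡-sym (count2≡sum f))
  where
  P? = λ ((i , j) : Fin k × Fin k) → f i j ≟ᵇ true
  -- Stated for an arbitrary tabulation, as the tail of `tabulate h` is `tabulate (h ∘ suc)` and no
  -- longer a full list of vertices.
  row : ∀ {l} i (h : Fin l → Fin k) → length (filter P? (map (i ,_) (tabulate h))) ≡ sum (λ j → ind (f i (h j)))
  row {zero}  i h = refl
  row {suc l} i h with f i (h zero)
  ... | true  = cong suc (row i (h ∘ suc))
  ... | false = row i (h ∘ suc)
  rows : ∀ {l} (g : Fin l → Fin k) →
         length (filter P? (cartesianProduct (tabulate g) (List.allFin k))) ≡ sum (λ i → sum (λ j → ind (f (g i) j)))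
  rows {zero}  g = refl
  rows {suc l} g = begin
    length (filter P? (map (g zero ,_) (List.allFin k) List.++ rest))
      ≡⟨ cong length (filter-++ P? (map (g zero ,_) (List.allFin k)) rest) ⟩
    length (filter P? (map (g zero ,_) (List.allFin k)) List.++ filter P? rest)
      ≡⟨ length-++ (filter P? (map (g zero ,_) (List.allFin k))) ⟩
    length (filter P? (map (g zero ,_) (List.allFin k))) + length (filter P? rest)
      ≡⟨ cong₂ _+_ (row (g zero) id) (rows (g ∘ suc)) ⟩
    sum (λ j → ind (f (g zero) j)) + sum (λ i → sum (λ j → ind (f (g (suc i)) j))) ∎
    where
    open ≡-Reasoning
    rest = cartesianProduct (tabulate (g ∘ suc)) (List.allFin k)

pair-elim : ∀ {k} {u v : Fin k} i → pair u v i ≡ true → (i ≡ u) ⊎ (i ≡ v)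
pair-elim {u = u} {v} i h with ∨-cases ⌊ i ≟ u ⌋ h
... | inj₁ e = inj₁ (≟-sound i u e)
... | inj₂ e = inj₂ (≟-sound i v e)

pair-introˡ : ∀ {k} (u v : Fin k) → pair u v u ≡ true
pair-introˡ u v rewrite ≟-refl u = refl

pair-introʳ : ∀ {k} (u v : Fin k) → pair u v v ≡ true
pair-introʳ u v with ⌊ v ≟ u ⌋
... | true  = refl
... | false = ≟-refl v

pair-⊆ : ∀ {k} {u v : Fin k} (p : Subset k) → p u ≡ true → p v ≡ true → pair u v ⊆ p
pair-⊆ p pu pv i h with pair-elim i h
... | inj₁ refl = pu
... | inj₂ refl = pv

avoids : ∀ {k} → List (Fin k × Fin k) → Subset k → Bool
avoids L p = all (λ (a , b) → not (p a ∧ p b)) L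

-- Subsets avoiding a list of pairs

module _ {k} (W : Subset k) {r} (|W| : count W ≡ suc r) where

  InW : Fin k × Fin k → Set
  InW (a , b) = (toℕ a < toℕ b) × (W a ≡ true) × (W b ≡ true)

  private
    hit : Fin k → Fin k → Fin k × Fin k → Fin k
    hit u v (a , b) = if pair u v a then b else a

    -- `hit` falls inside the pair only if both `a` and `b` do; as both pairs are increasing, they
    -- would then be equal.
    hit∉pair : ∀ {u v a b} → toℕ u < toℕ v → toℕ a < toℕ b → (u , v) ≢ (a , b) → pair u v (hit u v (a , b)) ≡ false
    hit∉pair {u} {v} {a} {b} u<v a<b ne with pair u v a in ea
    ... | false = ea
    ... | true with pair u v b in eb
    ...   | false = refl
    ...   | true with pair-elim a ea | pair-elim b eb
    ...     | inj₁ refl | inj₁ refl = contradiction a<b (<-irrefl refl)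
    ...     | inj₁ refl | inj₂ refl = contradiction refl ne
    ...     | inj₂ refl | inj₁ refl = contradiction a<b (<-asym u<v)
    ...     | inj₂ refl | inj₂ refl = contradiction a<b (<-irrefl refl)

    hit-or : ∀ u v a b (p : Subset k) → p (hit u v (a , b)) ≡ false → not (p a ∧ p b) ≡ true
    hit-or u v a b p h with pair u v a
    ... | false rewrite h = refl
    ... | true  rewrite h = cong not (∧-zeroʳ (p a))

  -- The t-sets through u and v inside W that skip one vertex off {u , v} of each pair of L.
  through-pair : ∀ {u v} L → InW (u , v) → All ((u , v) ≢_) L → All InW L → ∀ s x → length L + suc x ≡ r →
    x C s ≤ countSubsets (λ p → ((count p ≡ᵇ 2 + s) ∧ subᵇ p W ∧ avoids L p) ∧ (p u ∧ p v))
  through-pair {u} {v} L (u<v , Wu , Wv) ne inW s x len = begin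
    x C s
      ≤⟨ C-mono s (+-cancelˡ-≤ (2 + length L) _ _ freeEnough) ⟩
    count (λ i → F i ∧ not (pair u v i)) C s
      ≡⟨ cs-between′ (pair u v) F (count-pair u≢v) refl ⟨
    countSubsets (λ p → (count p ≡ᵇ 2 + s) ∧ between (pair u v) F p)
      ≤⟨ cs-mono sound ⟩
    countSubsets (λ p → ((count p ≡ᵇ 2 + s) ∧ subᵇ p W ∧ avoids L p) ∧ (p u ∧ p v)) ∎
    where
    open ≤-Reasoning
    u≢v : u ≢ v
    u≢v refl = <-irrefl refl u<v
    X F : Subset k
    X = member (map (hit u v) L)
    F i = W i ∧ not (X i)
    classify : ∀ i → W i ≡ true → (pair u v i ≡ true) ⊎ (X i ∨ (F i ∧ not (pair u v i)) ≡ true)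
    classify i w with pair u v i | X i
    ... | true  | _     = inj₁ refl
    ... | false | true  = inj₂ refl
    ... | false | false rewrite w = inj₂ refl
    -- `W` has `r + 1 = 2 + length L + x` vertices. The ends `u`, `v` and the skipped vertices use
    -- up at most `2 + length L` of them; coincidences among the skipped ones only help.
    freeEnough : 2 + length L + x ≤ 2 + length L + count (λ i → F i ∧ not (pair u v i))
    freeEnough = begin
      2 + length L + x ≡⟨ cong suc (+-suc (length L) x) ⟨
      suc (length L + suc x) ≡⟨ cong suc len ⟩
      suc r ≡⟨ |W| ⟨
      count W ≤⟨ count-∪ W (pair u v) _ classify ⟩
      count (pair u v) + count (λ i → X i ∨ (F i ∧ not (pair u v i)))
        ≤⟨ +-monoʳ-≤ (count (pair u v)) (count-∪ _ X _ (λ i → ∨-cases (X i))) ⟩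
      count (pair u v) + (count X + count (λ i → F i ∧ not (pair u v i)))
        ≤⟨ +-mono-≤ (≤-reflexive (count-pair u≢v)) (+-monoˡ-≤ _
             (≤-trans (count-member (map (hit u v) L)) (≤-reflexive (length-map (hit u v) L)))) ⟩
      2 + length L + count (λ i → F i ∧ not (pair u v i)) ∎
    sound : ∀ p → (count p ≡ᵇ 2 + s) ∧ between (pair u v) F p ≡ true →
            ((count p ≡ᵇ 2 + s) ∧ subᵇ p W ∧ avoids L p) ∧ (p u ∧ p v) ≡ true
    sound p h = ∧-true (∧-true (∧-conicalˡ (count p ≡ᵇ 2 + s) _ h) (∧-true inside (avoid L ne inW λ m → m)))
                       (∧-true (between-elimˡ {A = pair u v} {F} btw u (pair-introˡ u v))
                               (between-elimˡ {A = pair u v} {F} btw v (pair-introʳ u v)))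
      where
      btw : between (pair u v) F p ≡ true
      btw = ∧-conicalʳ (count p ≡ᵇ 2 + s) _ h
      inside : subᵇ p W ≡ true
      inside = allFin-intro _ λ i → ⇒-true λ pi → helper i (between-elimʳ {A = pair u v} {F} btw i pi)
        where
        helper : ∀ i → (pair u v i ≡ true) ⊎ (F i ≡ true) → W i ≡ true
        helper i (inj₁ e) = pair-⊆ W Wu Wv i e
        helper i (inj₂ e) = ∧-conicalˡ _ _ e
      skip : ∀ y → X y ≡ true → pair u v y ≡ false → p y ≡ false
      skip y Xy y∉ with p y in py
      ... | false = refl
      ... | true with between-elimʳ {A = pair u v} {F} btw y py
      ...   | inj₁ e = true≢false e y∉
      ...   | inj₂ e = true≢false Xy (not-true⇒false (∧-conicalʳ (W y) _ e))
      -- The recursion runs over a part `L′` of the list because `X` is built from the whole of `L`.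
      avoid : ∀ L′ → All ((u , v) ≢_) L′ → All InW L′ → (∀ {g} → g ∈ L′ → g ∈ L) → avoids L′ p ≡ true
      avoid [] _ _ _ = refl
      avoid ((a , b) ∷ L′) (n ∷ ns) ((a<b , _) ∷ ws) inc = ∧-true
        (hit-or u v a b p (skip _ (member-complete (∈-map⁺ (hit u v) (inc (here refl)))) (hit∉pair u<v a<b n)))
        (avoid L′ ns ws (inc ∘ there))

  -- `x` is what the list leaves of `r`. For the empty list `x = r`, and the bound is Pascal's
  -- expansion of the number of all sets of size `2 + s` in `W`. A further pair excludes at least
  -- `x C s` sets, which is exactly the drop from `suc x C (1 + s)` to `x C (1 + s)`.
  avoids-bound : ∀ L → Unique L → All InW L → ∀ s x → length L + x ≡ r →
    countSubsets (λ p → (count p ≡ᵇ 2 + s) ∧ subᵇ p W ∧ avoids L p) ≤ r C (2 + s) + x C (1 + s)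
  avoids-bound [] _ _ s x refl = begin
    countSubsets (λ p → (count p ≡ᵇ 2 + s) ∧ subᵇ p W ∧ true)
      ≤⟨ cs-mono sound ⟩
    countSubsets (λ p → (count p ≡ᵇ 2 + s) ∧ between ∅ W p)
      ≡⟨ cs-between′ ∅ W (count-empty {k} _ (λ _ → refl)) refl ⟩
    count (λ i → W i ∧ true) C (2 + s)
      ≤⟨ C-mono (2 + s) (≤-trans (count-mono {p = λ i → W i ∧ true} (λ i → ∧-conicalˡ _ _)) (≤-reflexive |W|)) ⟩
    suc r C (2 + s)
      ≡⟨ pascal r (suc s) ⟩
    r C (1 + s) + r C (2 + s)
      ≡⟨ +-comm (r C (1 + s)) _ ⟩
    r C (2 + s) + r C (1 + s) ∎
    where
    open ≤-Reasoning
    ∅ : Subset k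
    ∅ _ = false
    sound : ∀ p → (count p ≡ᵇ 2 + s) ∧ subᵇ p W ∧ true ≡ true → (count p ≡ᵇ 2 + s) ∧ between ∅ W p ≡ true
    sound p h = ∧-true (∧-conicalˡ (count p ≡ᵇ 2 + s) _ h) (∧-conicalˡ (subᵇ p W) _ (∧-conicalʳ (count p ≡ᵇ 2 + s) _ h))
  -- Adding the number of excluded sets to both sides replaces a subtraction.
  avoids-bound ((u , v) ∷ L) (ne ∷ uniq) (w ∷ ws) s x len = +-cancelˡ-≤ (x C s) _ _ (begin
    x C s + countSubsets (λ p → (count p ≡ᵇ 2 + s) ∧ subᵇ p W ∧ avoids ((u , v) ∷ L) p)
      ≤⟨ +-mono-≤ (through-pair L w ne ws s x len′) (cs-mono sound) ⟩
    countSubsets (λ p → P p ∧ (p u ∧ p v)) + countSubsets (λ p → P p ∧ not (p u ∧ p v))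
      ≡⟨ cs-split P (λ p → p u ∧ p v) ⟨
    countSubsets P
      ≤⟨ avoids-bound L uniq ws s (suc x) len′ ⟩
    r C (2 + s) + suc x C (1 + s)
      ≡⟨ cong (r C (2 + s) +_) (pascal x s) ⟩
    r C (2 + s) + (x C s + x C (1 + s))
      ≡⟨ +-assoc (r C (2 + s)) (x C s) _ ⟨
    r C (2 + s) + x C s + x C (1 + s)
      ≡⟨ cong (_+ x C (1 + s)) (+-comm (r C (2 + s)) (x C s)) ⟩
    x C s + r C (2 + s) + x C (1 + s)
      ≡⟨ +-assoc (x C s) _ _ ⟩
    x C s + (r C (2 + s) + x C (1 + s)) ∎)
    where
    open ≤-Reasoning
    len′ : length L + suc x ≡ r
    len′ = trans (+-suc (length L) x) len
    P : Subset k → Bool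
    P p = (count p ≡ᵇ 2 + s) ∧ subᵇ p W ∧ avoids L p
    reassoc : ∀ a b c d → a ∧ b ∧ (c ∧ d) ≡ true → (a ∧ b ∧ d) ∧ c ≡ true
    reassoc true true true true _ = refl
    sound : ∀ p → (count p ≡ᵇ 2 + s) ∧ subᵇ p W ∧ avoids ((u , v) ∷ L) p ≡ true → P p ∧ not (p u ∧ p v) ≡ true
    sound p = reassoc (count p ≡ᵇ 2 + s) (subᵇ p W) (not (p u ∧ p v)) (avoids L p)

-- Sets containing an edge of a list

-- f stands for the edges of B, and L for those of them that p may contain.
record Crossing {k} (f : Fin k → Fin k → Bool) (L : List (Fin k × Fin k)) (p : Subset k) : Set where
  field
    edge    : ∃[ u ] ∃[ v ] (p u ≡ true) × (p v ≡ true) × (f u v ≡ true)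
    listed  : ∀ {u v} → p u ≡ true → p v ≡ true → f u v ≡ true → (u , v) ∈ L
    spanned : ∀ {u v w} → p u ≡ true → p v ≡ true → f u v ≡ true → p w ≡ true →
              (f w v ≡ true) ⊎ (f u w ≡ true)

-- If p contains the first pair (u , v) of L, every further vertex of p is joined to u or v by a
-- later pair of L, so p ∖ {u , v} is contained in a set of at most length L − 1 vertices.
crossing-bound : ∀ {k} (f : Fin k → Fin k → Bool) L → All (λ (u , v) → u ≢ v × f u v ≡ true) L →
  ∀ s (P : Subset k → Bool) → (∀ p → P p ≡ true → count p ≡ 2 + s × Crossing f L p) →
  countSubsets P ≤ length L C (1 + s)
crossing-bound f [] _ s P h = ≤-reflexive (cs-empty P none)
  where
  none : ∀ p → P p ≡ false
  none p with P p in e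
  ... | false = refl
  ... | true with h p e
  ...   | _ , c with Crossing.edge c
  ...     | u , v , pu , pv , fuv with () ← Crossing.listed c pu pv fuv
crossing-bound {k} f ((u , v) ∷ L) ((u≢v , fuv) ∷ fL) s P h = begin
  countSubsets P
    ≡⟨ cs-split P (λ p → p u ∧ p v) ⟩
  countSubsets (λ p → P p ∧ (p u ∧ p v)) + countSubsets (λ p → P p ∧ not (p u ∧ p v))
    ≤⟨ +-mono-≤ (cs-mono star) (crossing-bound f L fL s _ off) ⟩
  countSubsets (λ p → (count p ≡ᵇ 2 + s) ∧ between (pair u v) X p) + length L C (1 + s)
    ≡⟨ cong (_+ length L C (1 + s)) (cs-between′ (pair u v) X (count-pair u≢v) refl) ⟩
  count (λ i → X i ∧ not (pair u v i)) C s + length L C (1 + s)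
    ≤⟨ +-monoˡ-≤ _ (C-mono s few) ⟩
  length L C s + length L C (1 + s)
    ≡⟨ pascal (length L) s ⟨
  suc (length L) C (1 + s) ∎
  where
  open ≤-Reasoning
  -- Sends `(u , w)` to `w`, and `(w , v)` with `w ≢ u` to `w` too: in either case it recovers the
  -- further vertex that the pair joins to `u` or `v`.
  other : Fin k × Fin k → Fin k
  other (a , b) = if ⌊ a ≟ u ⌋ then b else a
  X : Subset k
  X = member (map other L)
  few : count (λ i → X i ∧ not (pair u v i)) ≤ length L
  few = ≤-trans (count-mono {p = λ i → X i ∧ not (pair u v i)} (λ i → ∧-conicalˡ _ _))
    (≤-trans (count-member (map other L)) (≤-reflexive (length-map other L)))
  -- A set that misses `u` or `v` cannot use the first pair, so all its pairs are listed in the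
  -- tail; `edge` and `spanned` do not mention the list and carry over.
  off : ∀ p → P p ∧ not (p u ∧ p v) ≡ true → count p ≡ 2 + s × Crossing f L p
  off p e with h p (∧-conicalˡ _ _ e)
  ... | c , x = c , record { edge = edge ; spanned = spanned ; listed = λ pa pb fab → tail pa pb (listed pa pb fab) }
    where
    open Crossing x
    tail : ∀ {a b} → p a ≡ true → p b ≡ true → (a , b) ∈ ((u , v) ∷ L) → (a , b) ∈ L
    tail pa pb (here refl) = true≢false (∧-true pa pb) (not-true⇒false (∧-conicalʳ (P p) _ e))
    tail pa pb (there m)   = m
  star : ∀ p → P p ∧ (p u ∧ p v) ≡ true → (count p ≡ᵇ 2 + s) ∧ between (pair u v) X p ≡ true
  star p e with h p (∧-conicalˡ _ _ e)
  ... | c , x = ∧-true (trans (cong (_≡ᵇ 2 + s) c) (≡ᵇ-refl (2 + s)))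
                       (between-intro {A = pair u v} {X} (pair-⊆ p pu pv) cover)
    where
    open Crossing x
    pu : p u ≡ true
    pu = ∧-conicalˡ _ _ (∧-conicalʳ (P p) _ e)
    pv : p v ≡ true
    pv = ∧-conicalʳ (p u) _ (∧-conicalʳ (P p) _ e)
    inX : ∀ {w g} → g ∈ L → other g ≡ w → X w ≡ true
    inX m refl = member-complete (∈-map⁺ other m)
    cover : ∀ w → p w ≡ true → (pair u v w ≡ true) ⊎ (X w ≡ true)
    cover w pw with spanned pu pv fuv pw
    cover w pw | inj₁ fwv with listed pw pv fwv
    ... | here refl = inj₁ (pair-introˡ u v)
    ... | there m with w ≟ u
    ...   | yes refl = inj₁ refl
    ...   | no w≢u = inj₂ (inX m (cong (if_then v else w) (≟-≢ w≢u)))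
    cover w pw | inj₂ fuw with listed pu pw fuw
    ... | here refl = inj₁ (pair-introʳ u v)
    ... | there m = inj₂ (inX m (cong (if_then w else u) (≟-refl u)))

-- The clique test and the clique predicate

clique-intro : ∀ G {p} → IsClique G p → isCliqueᵇ G p ≡ true
clique-intro G {p} h = allFin-intro _ λ i → allFin-intro _ λ j → ⇒-true λ e →
  h i j (∧-conicalˡ _ _ e) (∧-conicalˡ _ _ (∧-conicalʳ (p i) _ e)) (distinct i j (∧-conicalʳ (p j) _ (∧-conicalʳ (p i) _ e)))
  where
  distinct : ∀ i j → not ⌊ i ≟ j ⌋ ≡ true → i ≢ j
  distinct i j e refl = true≢false (≟-refl i) (not-true⇒false e)

clique-elim : ∀ G {p} → isCliqueᵇ G p ≡ true → IsClique G p
clique-elim G {p} h i j pi pj ne =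
  ⇒-elim (allFin-elim _ (allFin-elim _ h i) j) (∧-true pi (∧-true pj (cong not (≟-≢ ne))))

-- The colex graph

C2-suc : ∀ b → suc b C 2 ≡ b C 2 + b
C2-suc b = trans (pascal b 1) (trans (cong (_+ b C 2) (nC1≡n b)) (+-comm b _))

sumBelow-cong : ∀ b {g h : ℕ → ℕ} → (∀ {i} → i < b → g i ≡ h i) → sumBelow b g ≡ sumBelow b h
sumBelow-cong zero    e = refl
sumBelow-cong (suc b) e = cong₂ _+_ (sumBelow-cong b (λ i<b → e (m≤n⇒m≤1+n i<b))) (e ≤-refl)

sumBelow-id : ∀ b → sumBelow b id ≡ b C 2
sumBelow-id zero    = refl
sumBelow-id (suc b) = trans (cong (_+ b) (sumBelow-id b)) (≡-sym (C2-suc b))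

countBelow-all : ∀ b {p : ℕ → Bool} → (∀ {i} → i < b → p i ≡ true) → countBelow b p ≡ b
countBelow-all zero    h = refl
countBelow-all (suc b) h =
  trans (cong₂ (λ c x → c + ind x) (countBelow-all b (λ i<b → h (m≤n⇒m≤1+n i<b))) (h ≤-refl)) (+-comm b 1)

countBelow-< : ∀ {a} b → a ≤ b → countBelow b (_<ᵇ a) ≡ a
countBelow-< {a} b a≤b with m≤n⇒m<n∨m≡n a≤b
... | inj₂ refl = countBelow-all a <ᵇ-complete
countBelow-< {a} (suc b) a≤b | inj₁ (s≤s a≤b′) =
  trans (cong₂ (λ c x → c + ind x) (countBelow-< b a≤b′) (≮ᵇ-complete a≤b′)) (+-identityʳ a)

countBelow-cong : ∀ b {p q : ℕ → Bool} → (∀ i → p i ≡ q i) → countBelow b p ≡ countBelow b q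
countBelow-cong zero    e = refl
countBelow-cong (suc b) e = cong₂ (λ c x → c + ind x) (countBelow-cong b e) (e b)

-- All `b C 2` pairs with larger end below `b` come earlier, followed by the pairs with larger end
-- `b` and smaller end below `a`.
colexRank-≡ : ∀ {a b} → a ≤ b → colexRank a b ≡ b C 2 + a
colexRank-≡ {a} {b} a≤b = cong₂ _+_
  (trans (sumBelow-cong b λ {b′} b′<b → countBelow-all b′ λ {a′} _ → cong (_∨ ((b′ ≡ᵇ b) ∧ (a′ <ᵇ a))) (<ᵇ-complete b′<b)) (sumBelow-id b))
  (trans (countBelow-cong b λ a′ → cong₂ (λ x y → x ∨ (y ∧ (a′ <ᵇ a))) (≮ᵇ-complete (≤-refl {b})) (≡ᵇ-refl b))
         (countBelow-< b a≤b))

colexEdge-≡ : ∀ N a b → colexEdgeℕ N a b ≡ (a <ᵇ b) ∧ (b C 2 + a <ᵇ N)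
colexEdge-≡ N a b with a <ᵇ b in e
... | false = refl
... | true  = cong (_<ᵇ N) (colexRank-≡ (<⇒≤ (<ᵇ-sound a b e)))

colexEdge-intro : ∀ {N a b} → a < b → b C 2 + a < N → colexEdgeℕ N a b ≡ true
colexEdge-intro {N} {a} {b} a<b h = trans (colexEdge-≡ N a b) (∧-true (<ᵇ-complete a<b) (<ᵇ-complete h))

colexEdge-elim : ∀ {N a b} → colexEdgeℕ N a b ≡ true → a < b × b C 2 + a < N
colexEdge-elim {N} {a} {b} h with trans (≡-sym (colexEdge-≡ N a b)) h
... | e = <ᵇ-sound a b (∧-conicalˡ _ _ e) , <ᵇ-sound _ _ (∧-conicalʳ (a <ᵇ b) _ e)

-- The pairs with larger end `j` occupy the `j` consecutive ranks from `j C 2` on, of which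
-- `j ⊓ (N ∸ j C 2)` lie below `N`. The number `k` of vertices is kept apart from `N` so that these
-- columns can be added one by one.
edges-colexOn : ∀ N k → edges (colexOn N k) ≡ (k C 2) ⊓ N
edges-colexOn N k = begin
  edges (colexOn N k)
    ≡⟨ count2≡sum {k} _ ⟩
  sum (λ i → sum (λ j → ind ((toℕ i <ᵇ toℕ j) ∧ adj (colexOn N k) i j)))
    ≡⟨ sum-cong-≗ {k} (λ i → sum-cong-≗ {k} (λ j → cong ind (oriented (toℕ i) (toℕ j)))) ⟩
  sum {k} (λ i → sum {k} (λ j → ind (toℕ i <ᵇ toℕ j ⊓ (N ∸ toℕ j C 2))))
    ≡⟨ ∑-comm {k} {k} (λ i j → ind (toℕ i <ᵇ toℕ j ⊓ (N ∸ toℕ j C 2))) ⟩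
  sum {k} (λ j → sum {k} (λ i → ind (toℕ i <ᵇ toℕ j ⊓ (N ∸ toℕ j C 2))))
    ≡⟨ sum-cong-≗ {k} column ⟩
  sum {k} (λ j → toℕ j ⊓ (N ∸ toℕ j C 2))
    ≡⟨ sum-toℕ k (λ j → j ⊓ (N ∸ j C 2)) ⟩
  sumBelow k (λ j → j ⊓ (N ∸ j C 2))
    ≡⟨ layers k ⟩
  (k C 2) ⊓ N ∎
  where
  open ≡-Reasoning
  to : ∀ a b → (a <ᵇ b) ∧ colexAdjℕ N a b ≡ true → (a <ᵇ b ⊓ (N ∸ b C 2)) ≡ true
  to a b h with ∨-cases (colexEdgeℕ N a b) (∧-conicalʳ (a <ᵇ b) _ h)
  ... | inj₂ e = contradiction (proj₁ (colexEdge-elim {N} {b} {a} e)) (<-asym (<ᵇ-sound a b (∧-conicalˡ _ _ h)))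
  ... | inj₁ e with colexEdge-elim {N} {a} {b} e
  ...   | a<b , lt = <ᵇ-complete (⊓-pres-m< a<b (m+n≤o⇒m≤o∸n (suc a) (subst (_< N) (+-comm (b C 2) a) lt)))
  from : ∀ a b → (a <ᵇ b ⊓ (N ∸ b C 2)) ≡ true → (a <ᵇ b) ∧ colexAdjℕ N a b ≡ true
  from a b h = ∧-true (<ᵇ-complete a<b) (cong (_∨ colexEdgeℕ N b a) (colexEdge-intro {N} a<b
    (subst (_< N) (+-comm a (b C 2)) (m≤o∸n⇒m+n≤o (suc a) (<⇒≤ (m∸n≢0⇒n<m (m<n⇒n≢0 lt₂))) lt₂))))
    where
    lt : a < b ⊓ (N ∸ b C 2)
    lt = <ᵇ-sound a _ h
    a<b : a < b
    a<b = m<n⊓o⇒m<n b _ lt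
    lt₂ : a < N ∸ b C 2
    lt₂ = m<n⊓o⇒m<o b _ lt
  oriented : ∀ a b → (a <ᵇ b) ∧ colexAdjℕ N a b ≡ (a <ᵇ b ⊓ (N ∸ b C 2))
  oriented a b = bool-ext (to a b) (from a b)
  column : (j : Fin k) → sum {k} (λ i → ind (toℕ i <ᵇ toℕ j ⊓ (N ∸ toℕ j C 2))) ≡ toℕ j ⊓ (N ∸ toℕ j C 2)
  column j = trans (≡-sym (count≡sum {k} (λ i → toℕ i <ᵇ toℕ j ⊓ (N ∸ toℕ j C 2))))
                   (count-below (≤-trans (m⊓n≤m (toℕ j) (N ∸ toℕ j C 2)) (<⇒≤ (toℕ<n j))))
  -- Truncated subtraction matters here: once `a` exceeds `N`, the next column contributes nothing.
  fill : ∀ a k → a ⊓ N + k ⊓ (N ∸ a) ≡ (a + k) ⊓ N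
  fill a k with ≤-total a N
  ... | inj₁ a≤N = begin
    a ⊓ N + k ⊓ (N ∸ a)       ≡⟨ cong (_+ k ⊓ (N ∸ a)) (m≤n⇒m⊓n≡m a≤N) ⟩
    a + k ⊓ (N ∸ a)           ≡⟨ +-distribˡ-⊓ a k (N ∸ a) ⟩
    (a + k) ⊓ (a + (N ∸ a))   ≡⟨ cong ((a + k) ⊓_) (m+[n∸m]≡n a≤N) ⟩
    (a + k) ⊓ N               ∎
  ... | inj₂ N≤a = begin
    a ⊓ N + k ⊓ (N ∸ a)       ≡⟨ cong₂ (λ x y → x + k ⊓ y) (m≥n⇒m⊓n≡n N≤a) (m≤n⇒m∸n≡0 N≤a) ⟩
    N + k ⊓ 0                 ≡⟨ cong (N +_) (⊓-zeroʳ k) ⟩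
    N + 0                     ≡⟨ +-identityʳ N ⟩
    N                         ≡⟨ m≥n⇒m⊓n≡n (≤-trans N≤a (m≤m+n a k)) ⟨
    (a + k) ⊓ N               ∎
  layers : ∀ k → sumBelow k (λ j → j ⊓ (N ∸ j C 2)) ≡ (k C 2) ⊓ N
  layers zero    = refl
  layers (suc k) = trans (cong (_+ k ⊓ (N ∸ k C 2)) (layers k))
                         (trans (fill (k C 2) k) (cong (_⊓ N) (≡-sym (C2-suc k))))

-- No edge is cut off: `suc N` vertices have `N C 2 + N` pairs, which is at least `N`.
edges-colex : ∀ N → edges (colex N) ≡ N
edges-colex N = trans (edges-colexOn N (suc N))
  (m≥n⇒m⊓n≡n (≤-trans (m≤n+m N (N C 2)) (≤-reflexive (≡-sym (C2-suc N)))))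

C2-cancel-< : ∀ {b c} → b C 2 < c C 2 → b < c
C2-cancel-< lt = ≰⇒> λ c≤b → <⇒≱ lt (C-mono 2 c≤b)

-- An edge with larger end `b` has rank at least `b C 2`, and this is below `suc r C 2` only if
-- `b < suc r`.
colexAdj-bounded : ∀ {N r a b} → N ≤ suc r C 2 → colexAdjℕ N a b ≡ true → a < suc r × b < suc r
colexAdj-bounded {N} {r} {a} {b} N≤ h with ∨-cases (colexEdgeℕ N a b) h
... | inj₁ e = <-trans (proj₁ (edge e)) (proj₂ (edge e)) , proj₂ (edge e)
  where
  edge : colexEdgeℕ N a b ≡ true → a < b × b < suc r
  edge e with colexEdge-elim {N} {a} {b} e
  ... | a<b , lt = a<b , C2-cancel-< (≤-trans (s≤s (m≤m+n _ a)) (≤-trans lt N≤))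
... | inj₂ e = proj₂ (edge e) , <-trans (proj₁ (edge e)) (proj₂ (edge e))
  where
  edge : colexEdgeℕ N b a ≡ true → b < a × a < suc r
  edge e with colexEdge-elim {N} {b} {a} e
  ... | a<b , lt = a<b , C2-cancel-< (≤-trans (s≤s (m≤m+n _ b)) (≤-trans lt N≤))

-- All edges lie on the first `r + 1` vertices, so a vertex beyond them is isolated and one among
-- them has at most `r` possible neighbours.
maxDeg-colex : ∀ {N r} → N ≤ suc r C 2 → MaxDegLe (colex N) r
maxDeg-colex {N} {r} N≤ v with suc (toℕ v) ≤? suc r
... | no v≰r = ≤-trans (≤-reflexive (count-empty (adj (colex N) v) isolated)) z≤n
  where
  isolated : ∀ j → adj (colex N) v j ≡ false
  isolated j with adj (colex N) v j in e
  ... | false = refl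
  ... | true  = contradiction (proj₁ (colexAdj-bounded {N} {b = toℕ j} N≤ e)) v≰r
... | yes v≤r = s≤s⁻¹ (begin
  suc (degree (colex N) v)
    ≡⟨ cong (_+ degree (colex N) v) (count-singleton v) ⟨
  count (λ j → ⌊ j ≟ v ⌋) + degree (colex N) v
    ≤⟨ count-disjoint below-v below-adj apart ⟩
  count {suc N} (λ j → toℕ j <ᵇ suc r)
    ≤⟨ count-below-≤ (suc N) (suc r) ⟩
  suc r ∎)
  where
  open ≤-Reasoning
  below-v : ∀ j → ⌊ j ≟ v ⌋ ≡ true → (toℕ j <ᵇ suc r) ≡ true
  below-v j e rewrite ≟-sound j v e = <ᵇ-complete v≤r
  below-adj : ∀ j → adj (colex N) v j ≡ true → (toℕ j <ᵇ suc r) ≡ true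
  below-adj j e = <ᵇ-complete (proj₂ (colexAdj-bounded {N} {a = toℕ v} N≤ e))
  apart : ∀ j → adj (colex N) v j ≡ true → ⌊ j ≟ v ⌋ ≡ false
  apart j e = ≟-≢ λ { refl → true≢false e (irrefl (colex N) v) }

colex-clique : ∀ N (p : Subset (suc N)) →
  (∀ i j → p i ≡ true → p j ≡ true → toℕ i < toℕ j → toℕ j C 2 + toℕ i < N) → isCliqueᵇ (colex N) p ≡ true
colex-clique N p h = clique-intro (colex N) adjacent
  where
  adjacent : IsClique (colex N) p
  adjacent i j pi pj i≢j with <-cmp (toℕ i) (toℕ j)
  ... | tri< lt _ _ = cong (_∨ colexEdgeℕ N (toℕ j) (toℕ i)) (colexEdge-intro {N} lt (h i j pi pj lt))
  ... | tri≈ _ e _  = contradiction (toℕ-injective e) i≢j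
  ... | tri> _ _ gt = trans (sym (colex N) i j) (cong (_∨ colexEdgeℕ N (toℕ i) (toℕ j)) (colexEdge-intro {N} gt (h j i pj pi gt)))

-- `colex (r C 2 + y)` has one vertex more than it has edges; this guarantees it the `r` vertices of
-- its complete part.
r≤1+C2 : ∀ r → r ≤ suc (r C 2)
r≤1+C2 zero    = z≤n
r≤1+C2 (suc r) = s≤s (≤-trans (m≤n+m r (r C 2)) (≤-reflexive (≡-sym (C2-suc r))))

-- The colex order exhausts the pairs below `r` before any other, so the first `r C 2` edges form a
-- complete graph.
pair-in-C2 : ∀ {i j r} → i < j → j < r → j C 2 + i < r C 2
pair-in-C2 {i} {j} {r} i<j j<r = begin-strict
  j C 2 + i <⟨ +-monoʳ-< (j C 2) i<j ⟩
  j C 2 + j ≡⟨ C2-suc j ⟨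
  suc j C 2 ≤⟨ C-mono 2 j<r ⟩
  r C 2     ∎
  where open ≤-Reasoning

-- The vertices `0, …, r − 1` form a complete graph and the next `y` edges join the vertex `r` to
-- `0, …, y − 1`. The first summand counts cliques below `r`, the second those through `r`.
cliques-colex : ∀ r y s → y ≤ r → r C (2 + s) + y C (1 + s) ≤ cliques (2 + s) (colex (r C 2 + y))
cliques-colex r y s y≤r = main y≤r
  where
  open ≤-Reasoning
  K : ℕ → ℕ
  K y = suc (r C 2 + y)
  r≤K : ∀ y → r ≤ K y
  r≤K y = ≤-trans (r≤1+C2 r) (s≤s (m≤m+n _ y))
  ∅ below-r : ∀ {y} → Subset (K y)
  ∅ _ = false
  below-r i = toℕ i <ᵇ r
  Q : ∀ y → Subset (K y) → Bool
  Q y p = (count p ≡ᵇ 2 + s) ∧ between ∅ (below-r {y}) p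
  Q-below : ∀ y p → Q y p ≡ true → ∀ i → p i ≡ true → toℕ i < r
  Q-below y p h i pi with between-elimʳ {A = ∅} {below-r {y}} {p} (∧-conicalʳ (count p ≡ᵇ 2 + s) _ h) i pi
  ... | inj₂ e = <ᵇ-sound _ r e
  Q-clique : ∀ y p → Q y p ≡ true → (count p ≡ᵇ 2 + s) ∧ isCliqueᵇ (colex (r C 2 + y)) p ≡ true
  Q-clique y p h = ∧-true (∧-conicalˡ (count p ≡ᵇ 2 + s) _ h) (colex-clique (r C 2 + y) p λ i j pi pj i<j →
    ≤-trans (pair-in-C2 i<j (Q-below y p h j pj)) (m≤m+n _ y))
  Q-count : ∀ y → countSubsets (Q y) ≡ r C (2 + s)
  Q-count y = trans (cs-between′ ∅ (below-r {y}) (count-empty {K y} _ (λ _ → refl)) refl)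
    (cong (_C (2 + s)) (trans (count-cong {K y} {λ i → below-r {y} i ∧ true} {below-r {y}} (λ i → ∧-identityʳ _)) (count-below (r≤K y))))
  main : ∀ {y} → y ≤ r → r C (2 + s) + y C (1 + s) ≤ cliques (2 + s) (colex (r C 2 + y))
  -- For `y = 0` the vertex `r` need not exist in this graph, for instance when `r` is 1 or 2; nor
  -- is it needed, as `0 C (1 + s)` is 0.
  main {zero} _ = begin
    r C (2 + s) + 0                         ≡⟨ +-identityʳ _ ⟩
    r C (2 + s)                             ≡⟨ Q-count 0 ⟨
    countSubsets (Q 0)                      ≤⟨ cs-mono (Q-clique 0) ⟩
    cliques (2 + s) (colex (r C 2 + 0))     ∎
  main {y@(suc y′)} y≤r = begin
    r C (2 + s) + y C (1 + s)
      ≤⟨ +-mono-≤ (≤-reflexive (≡-sym (Q-count y))) (C-mono (1 + s) enough) ⟩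
    countSubsets (Q y) + count (λ i → below-y i ∧ not (top i)) C (1 + s)
      ≡⟨ cong (countSubsets (Q y) +_) (cs-between′ top below-y (count-singleton ρ) refl) ⟨
    countSubsets (Q y) + countSubsets Q′
      ≤⟨ cs-disjoint (Q-clique y) Q′-clique apart ⟩
    cliques (2 + s) (colex (r C 2 + y)) ∎
    where
    r<K : r < K y
    r<K = s≤s (≤-trans (r≤1+C2 r) (≤-trans (s≤s (m≤m+n _ y′)) (≤-reflexive (≡-sym (+-suc (r C 2) y′)))))
    ρ : Fin (K y)
    ρ = fromℕ< r<K
    ρ≡r : toℕ ρ ≡ r
    ρ≡r = toℕ-fromℕ< r<K
    top below-y : Subset (K y)
    top i = ⌊ i ≟ ρ ⌋
    below-y i = toℕ i <ᵇ y
    Q′ : Subset (K y) → Bool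
    Q′ p = (count p ≡ᵇ 2 + s) ∧ between top below-y p
    enough : y ≤ count (λ i → below-y i ∧ not (top i))
    enough = ≤-trans (≤-reflexive (≡-sym (count-below (≤-trans y≤r (r≤K y)))))
      (count-mono {p = below-y} {λ i → below-y i ∧ not (top i)} λ i b → ∧-true b (cong not (≟-≢ {i = i} {ρ}
        λ { refl → <⇒≱ (<ᵇ-sound (toℕ ρ) y b) (≤-trans y≤r (≤-reflexive (≡-sym ρ≡r))) })))
    btw : ∀ p → Q′ p ≡ true → between top below-y p ≡ true
    btw p h = ∧-conicalʳ (count p ≡ᵇ 2 + s) _ h
    apart : ∀ p → Q′ p ≡ true → Q y p ≡ false
    apart p h with Q y p in q
    ... | false = refl
    ... | true  = contradiction (Q-below y p q ρ (between-elimˡ {A = top} {below-y} {p} (btw p h) ρ (≟-refl ρ))) (<-irrefl ρ≡r)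
    Q′-clique : ∀ p → Q′ p ≡ true → (count p ≡ᵇ 2 + s) ∧ isCliqueᵇ (colex (r C 2 + y)) p ≡ true
    Q′-clique p h = ∧-true (∧-conicalˡ (count p ≡ᵇ 2 + s) _ h) (colex-clique (r C 2 + y) p adjacent)
      where
      below : ∀ i → p i ≡ true → (i ≡ ρ) ⊎ (toℕ i < y)
      below i pi with between-elimʳ {A = top} {below-y} {p} (btw p h) i pi
      ... | inj₁ e = inj₁ (≟-sound i ρ e)
      ... | inj₂ e = inj₂ (<ᵇ-sound _ y e)
      adjacent : ∀ i j → p i ≡ true → p j ≡ true → toℕ i < toℕ j → toℕ j C 2 + toℕ i < r C 2 + y
      adjacent i j pi pj i<j with below i pi | below j pj
      ... | _         | inj₂ j<y  = ≤-trans (pair-in-C2 i<j (≤-trans j<y y≤r)) (m≤m+n _ y)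
      ... | inj₂ i<y  | inj₁ refl rewrite ρ≡r = +-monoʳ-< (r C 2) i<y
      ... | inj₁ refl | inj₁ refl = contradiction i<j (<-irrefl refl)

count2-< : ∀ k → count2 {k} (λ i j → toℕ i <ᵇ toℕ j) ≡ k C 2
count2-< k = begin
  count2 {k} (λ i j → toℕ i <ᵇ toℕ j)              ≡⟨ count2-transpose {k} (λ i j → toℕ i <ᵇ toℕ j) ⟩
  count2 {k} (λ j i → toℕ i <ᵇ toℕ j)              ≡⟨ count2≡sum {k} (λ j i → toℕ i <ᵇ toℕ j) ⟩
  sum {k} (λ j → sum {k} (λ i → ind (toℕ i <ᵇ toℕ j)))
    ≡⟨ sum-cong-≗ {k} (λ j → trans (≡-sym (count≡sum {k} (λ i → toℕ i <ᵇ toℕ j))) (count-below (<⇒≤ (toℕ<n j)))) ⟩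
  sum {k} toℕ                                      ≡⟨ sum-toℕ k id ⟩
  sumBelow k id                                    ≡⟨ sumBelow-id k ⟩
  k C 2                                            ∎
  where open ≡-Reasoning

-- Disjoint unions

<ᵇ-shift : ∀ a x y → (a + x <ᵇ a + y) ≡ (x <ᵇ y)
<ᵇ-shift zero    x y = refl
<ᵇ-shift (suc a) x y = <ᵇ-shift a x y

module _ {a b} (f : Fin a → Fin a → Bool) (g : Fin b → Fin b → Bool) where

  unionAdj-ˡˡ : ∀ x y → unionAdj f g (x ↑ˡ b) (y ↑ˡ b) ≡ f x y
  unionAdj-ˡˡ x y rewrite splitAt-↑ˡ a x b | splitAt-↑ˡ a y b = refl

  unionAdj-ˡʳ : ∀ x y → unionAdj f g (x ↑ˡ b) (a ↑ʳ y) ≡ false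
  unionAdj-ˡʳ x y rewrite splitAt-↑ˡ a x b | splitAt-↑ʳ a b y = refl

  unionAdj-ʳˡ : ∀ x y → unionAdj f g (a ↑ʳ x) (y ↑ˡ b) ≡ false
  unionAdj-ʳˡ x y rewrite splitAt-↑ʳ a b x | splitAt-↑ˡ a y b = refl

  unionAdj-ʳʳ : ∀ x y → unionAdj f g (a ↑ʳ x) (a ↑ʳ y) ≡ g x y
  unionAdj-ʳʳ x y rewrite splitAt-↑ʳ a b x | splitAt-↑ʳ a b y = refl

-- Matching on this view turns an index of the union into the form in which the lemmas on `unionAdj`
-- and `_⧺_` apply.
data Split (a b : ℕ) : Fin (a + b) → Set where
  left  : ∀ x → Split a b (x ↑ˡ b)
  right : ∀ y → Split a b (a ↑ʳ y)

split : ∀ a b i → Split a b i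
split a b i with splitAt a i in e
... | inj₁ x = subst (Split a b) (splitAt⁻¹-↑ˡ e) (left x)
... | inj₂ y = subst (Split a b) (splitAt⁻¹-↑ʳ {m = a} e) (right y)

sum-zero : ∀ {k} {h : Fin k → ℕ} → (∀ i → h i ≡ 0) → sum h ≡ 0
sum-zero {k} e = trans (sum-cong-≗ {k} e) (sum-replicate-zero k)

module _ (G H : Graph) where
  private
    a = n G
    b = n H

  edges-⊕ : edges (G ⊕ H) ≡ edges G + edges H
  edges-⊕ = begin
    edges (G ⊕ H)
      ≡⟨ count2≡sum e ⟩
    sum (λ i → sum (λ j → ind (e i j)))
      ≡⟨ sum-++ a _ ⟩
    sum (λ x → sum (λ j → ind (e (x ↑ˡ b) j))) + sum (λ y → sum (λ j → ind (e (a ↑ʳ y) j)))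
      ≡⟨ cong₂ _+_ (sum-cong-≗ {a} rowˡ) (sum-cong-≗ {b} rowʳ) ⟩
    sum (λ x → sum (λ j → ind (eG x j))) + sum (λ y → sum (λ j → ind (eH y j)))
      ≡⟨ cong₂ _+_ (count2≡sum eG) (count2≡sum eH) ⟨
    edges G + edges H ∎
    where
    open ≡-Reasoning
    e : Fin (a + b) → Fin (a + b) → Bool
    e i j = (toℕ i <ᵇ toℕ j) ∧ adj (G ⊕ H) i j
    eG : Fin a → Fin a → Bool
    eG i j = (toℕ i <ᵇ toℕ j) ∧ adj G i j
    eH : Fin b → Fin b → Bool
    eH i j = (toℕ i <ᵇ toℕ j) ∧ adj H i j
    rowˡ : ∀ x → sum (λ j → ind (e (x ↑ˡ b) j)) ≡ sum (λ j → ind (eG x j))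
    rowˡ x = trans (sum-++ a _) (trans (cong₂ _+_
      (sum-cong-≗ {a} λ y → cong ind (cong₂ _∧_ (cong₂ _<ᵇ_ (toℕ-↑ˡ x b) (toℕ-↑ˡ y b)) (unionAdj-ˡˡ (adj G) (adj H) x y)))
      (sum-zero {b} λ y → cong ind (∧-falseʳ (unionAdj-ˡʳ (adj G) (adj H) x y)))) (+-identityʳ _))
    rowʳ : ∀ y → sum (λ j → ind (e (a ↑ʳ y) j)) ≡ sum (λ j → ind (eH y j))
    rowʳ x = trans (sum-++ a _) (cong₂ _+_
      (sum-zero {a} λ y → cong ind (∧-falseʳ (unionAdj-ʳˡ (adj G) (adj H) x y)))
      (sum-cong-≗ {b} λ y → cong ind (cong₂ _∧_ (trans (cong₂ _<ᵇ_ (toℕ-↑ʳ a x) (toℕ-↑ʳ a y)) (<ᵇ-shift a _ _)) (unionAdj-ʳʳ (adj G) (adj H) x y))))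

  maxDeg-⊕ : ∀ {r} → MaxDegLe G r → MaxDegLe H r → MaxDegLe (G ⊕ H) r
  maxDeg-⊕ {r} dG dH v with split a b v
  ... | left x = ≤-trans (≤-reflexive (trans (count-++ a _) (trans (cong₂ _+_
      (count-cong {a} (unionAdj-ˡˡ (adj G) (adj H) x)) (count-empty {b} _ (unionAdj-ˡʳ (adj G) (adj H) x))) (+-identityʳ _)))) (dG x)
  ... | right y = ≤-trans (≤-reflexive (trans (count-++ a _) (cong₂ _+_
      (count-empty {a} _ (unionAdj-ʳˡ (adj G) (adj H) y)) (count-cong {b} (unionAdj-ʳʳ (adj G) (adj H) y))))) (dH y)

-- Built from `cons`, as is `_⧺_`, because `countSubsets` evaluates its predicate on sets of that
-- form; a constant function would agree with them only pointwise.
∅ : ∀ {k} → Subset k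
∅ {zero}  = λ ()
∅ {suc k} = cons false ∅

_⧺_ : ∀ {a b} → Subset a → Subset b → Subset (a + b)
_⧺_ {zero}  p q = q
_⧺_ {suc a} p q = cons (p zero) ((λ i → p (suc i)) ⧺ q)

∅-false : ∀ {k} (i : Fin k) → ∅ i ≡ false
∅-false zero    = refl
∅-false (suc i) = ∅-false i

⧺-ˡ : ∀ {a b} (p : Subset a) (q : Subset b) x → (p ⧺ q) (x ↑ˡ b) ≡ p x
⧺-ˡ p q zero    = refl
⧺-ˡ p q (suc x) = ⧺-ˡ (p ∘ suc) q x

⧺-ʳ : ∀ {a b} (p : Subset a) (q : Subset b) y → (p ⧺ q) (a ↑ʳ y) ≡ q y
⧺-ʳ {zero}  p q y = refl
⧺-ʳ {suc a} p q y = ⧺-ʳ (p ∘ suc) q y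

cs-∅ : ∀ {k} (P : Subset k → Bool) → ind (P ∅) ≤ countSubsets P
cs-∅ {zero}  P = ≤-refl
cs-∅ {suc k} P = ≤-trans (cs-∅ (λ q → P (cons false q))) (m≤n+m _ _)

cs-⧺ˡ : ∀ {a b} (P : Subset (a + b) → Bool) → countSubsets {a} (λ p → P (p ⧺ ∅)) ≤ countSubsets P
cs-⧺ˡ {zero}  P = cs-∅ P
cs-⧺ˡ {suc a} P = +-mono-≤ (cs-⧺ˡ {a} (λ q → P (cons true q))) (cs-⧺ˡ {a} (λ q → P (cons false q)))

-- The sets inside the left part and those inside the right part share only the empty set, which the
-- hypothesis excludes from `P`. A set containing the first vertex belongs to the left family, so
-- that branch needs `cs-⧺ˡ` alone.
cs-⧺ : ∀ {a b} (P : Subset (a + b) → Bool) → P (∅ {a} ⧺ ∅ {b}) ≡ false →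
       countSubsets {a} (λ p → P (p ⧺ ∅)) + countSubsets {b} (λ q → P (∅ {a} ⧺ q)) ≤ countSubsets P
cs-⧺ {zero} {b} P e = ≤-reflexive (cong (λ x → ind x + countSubsets {b} P) e)
cs-⧺ {suc a} {b} P e = ≤-trans
  (≤-reflexive (+-assoc (countSubsets {a} (λ p → P (cons true (p ⧺ ∅)))) _ _))
  (+-mono-≤ (cs-⧺ˡ {a} {b} (λ q → P (cons true q))) (cs-⧺ {a} {b} (λ q → P (cons false q)) e))

-- The size is positive because the empty clique would be counted once in each part.
cliques-⊕ : ∀ t G H → cliques (suc t) G + cliques (suc t) H ≤ cliques (suc t) (G ⊕ H)
cliques-⊕ t G H = ≤-trans (+-mono-≤ (cs-mono inˡ) (cs-mono inʳ)) (cs-⧺ {a} {b} P P∅)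
  where
  a = n G
  b = n H
  P : Subset (a + b) → Bool
  P p = (count p ≡ᵇ suc t) ∧ isCliqueᵇ (G ⊕ H) p
  count-⧺ : ∀ (p : Subset a) (q : Subset b) → count (p ⧺ q) ≡ count p + count q
  count-⧺ p q = trans (count-++ a (p ⧺ q)) (cong₂ _+_ (count-cong {a} (⧺-ˡ p q)) (count-cong {b} (⧺-ʳ p q)))
  count-∅ : ∀ k → count (∅ {k}) ≡ 0
  count-∅ k = count-empty {k} ∅ ∅-false
  P∅ : P (∅ {a} ⧺ ∅ {b}) ≡ false
  P∅ rewrite count-⧺ ∅ ∅ | count-∅ a | count-∅ b = refl
  inˡ : ∀ p → (count p ≡ᵇ suc t) ∧ isCliqueᵇ G p ≡ true → P (p ⧺ ∅) ≡ true
  inˡ p h = ∧-true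
    (trans (cong (_≡ᵇ suc t) (trans (count-⧺ p ∅) (trans (cong (count p +_) (count-∅ b)) (+-identityʳ _)))) (∧-conicalˡ _ _ h))
    (clique-intro (G ⊕ H) clique)
    where
    clique : IsClique (G ⊕ H) (p ⧺ ∅)
    clique i j pi pj i≢j with split a b i | split a b j
    ... | right y | _       = true≢false pi (trans (⧺-ʳ p ∅ y) (∅-false y))
    ... | left x  | right y = true≢false pj (trans (⧺-ʳ p ∅ y) (∅-false y))
    ... | left x  | left y  = trans (unionAdj-ˡˡ (adj G) (adj H) x y)
      (clique-elim G (∧-conicalʳ (count p ≡ᵇ suc t) _ h) x y
        (trans (≡-sym (⧺-ˡ p ∅ x)) pi) (trans (≡-sym (⧺-ˡ p ∅ y)) pj) λ { refl → i≢j refl })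
  inʳ : ∀ q → (count q ≡ᵇ suc t) ∧ isCliqueᵇ H q ≡ true → P (∅ {a} ⧺ q) ≡ true
  inʳ q h = ∧-true
    (trans (cong (_≡ᵇ suc t) (trans (count-⧺ ∅ q) (cong (_+ count q) (count-∅ a)))) (∧-conicalˡ _ _ h))
    (clique-intro (G ⊕ H) clique)
    where
    clique : IsClique (G ⊕ H) (∅ {a} ⧺ q)
    clique i j pi pj i≢j with split a b i | split a b j
    ... | left x  | _       = true≢false pi (trans (⧺-ˡ ∅ q x) (∅-false x))
    ... | right x | left y  = true≢false pj (trans (⧺-ˡ ∅ q y) (∅-false y))
    ... | right x | right y = trans (unionAdj-ʳʳ (adj G) (adj H) x y)
      (clique-elim H (∧-conicalʳ (count q ≡ᵇ suc t) _ h) x y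
        (trans (≡-sym (⧺-ʳ {a} ∅ q x)) pi) (trans (≡-sym (⧺-ʳ {a} ∅ q y)) pj) λ { refl → i≢j refl })

-- Induced subgraphs

sum-enum : ∀ {k} (U : Subset k) (h : Fin k → ℕ) → sum (h ∘ enum U) ≡ sum (λ i → if U i then h i else 0)
sum-enum {zero}  U h = refl
sum-enum {suc k} U h with U zero
... | true  = cong (h zero +_) (sum-enum (U ∘ suc) (h ∘ suc))
... | false = sum-enum (U ∘ suc) (h ∘ suc)

-- `enum` lists `U` in increasing order. So counts over pairs `i < j` carry over to induced
-- subgraphs, and injectivity follows.
enum-< : ∀ {k} (U : Subset k) i j → (toℕ (enum U i) <ᵇ toℕ (enum U j)) ≡ (toℕ i <ᵇ toℕ j)
enum-< {suc k} U i j with U zero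
enum-< {suc k} U zero    zero    | true  = refl
enum-< {suc k} U zero    (suc j) | true  = refl
enum-< {suc k} U (suc i) zero    | true  = refl
enum-< {suc k} U (suc i) (suc j) | true  = enum-< (U ∘ suc) i j
enum-< {suc k} U i       j       | false = enum-< (U ∘ suc) i j

enum-injective : ∀ {k} (U : Subset k) {i j} → enum U i ≡ enum U j → i ≡ j
enum-injective U {i} {j} e with <-cmp (toℕ i) (toℕ j)
... | tri≈ _ eq _ = toℕ-injective eq
... | tri< lt _ _ = true≢false (trans (enum-< U i j) (<ᵇ-complete lt)) (≮ᵇ-complete (≤-reflexive (cong toℕ (≡-sym e))))
... | tri> _ _ gt = true≢false (trans (enum-< U j i) (<ᵇ-complete gt)) (≮ᵇ-complete (≤-reflexive (cong toℕ e)))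

if-ind : ∀ u x → (if u then ind x else 0) ≡ ind (u ∧ x)
if-ind true  x = refl
if-ind false x = refl

count-enum : ∀ {k} (U p : Subset k) → count (p ∘ enum U) ≡ count (λ i → U i ∧ p i)
count-enum {k} U p = trans (count≡sum (p ∘ enum U)) (trans (sum-enum U (ind ∘ p))
  (trans (sum-cong-≗ {k} (λ i → if-ind (U i) (p i))) (≡-sym (count≡sum (λ i → U i ∧ p i)))))

count2-enum : ∀ {k} (U : Subset k) (f : Fin k → Fin k → Bool) →
  count2 (λ i j → f (enum U i) (enum U j)) ≡ count2 (λ i j → U i ∧ U j ∧ f i j)
count2-enum {k} U f = begin
  count2 (λ i j → f (enum U i) (enum U j))
    ≡⟨ count2≡sum (λ i j → f (enum U i) (enum U j)) ⟩
  sum (λ i → sum (λ j → ind (f (enum U i) (enum U j))))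
    ≡⟨ sum-cong-≗ {count U} (λ i → sum-enum U (ind ∘ f (enum U i))) ⟩
  sum ((λ i → sum (λ j → if U j then ind (f i j) else 0)) ∘ enum U)
    ≡⟨ sum-enum U (λ i → sum (λ j → if U j then ind (f i j) else 0)) ⟩
  sum (λ i → if U i then sum (λ j → if U j then ind (f i j) else 0) else 0)
    ≡⟨ sum-cong-≗ {k} row ⟩
  sum (λ i → sum (λ j → ind (U i ∧ U j ∧ f i j)))
    ≡⟨ count2≡sum (λ i j → U i ∧ U j ∧ f i j) ⟨
  count2 (λ i j → U i ∧ U j ∧ f i j) ∎
  where
  open ≡-Reasoning
  row : ∀ i → (if U i then sum (λ j → if U j then ind (f i j) else 0) else 0) ≡ sum (λ j → ind (U i ∧ U j ∧ f i j))
  row i with U i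
  ... | true  = sum-cong-≗ {k} (λ j → if-ind (U j) (f i j))
  ... | false = ≡-sym (sum-replicate-zero k)

edges-induced : ∀ G U → edges (induced G U) ≡ count2 (λ i j → U i ∧ U j ∧ (toℕ i <ᵇ toℕ j) ∧ adj G i j)
edges-induced G U = trans (count2-cong {count U} (λ i j → cong (_∧ adj G (enum U i) (enum U j)) (≡-sym (enum-< U i j))))
                          (count2-enum U (λ i j → (toℕ i <ᵇ toℕ j) ∧ adj G i j))

count2-pairs : ∀ {k} (U : Subset k) → count2 (λ i j → U i ∧ U j ∧ (toℕ i <ᵇ toℕ j)) ≡ count U C 2
count2-pairs U = trans (≡-sym (count2-enum U (λ i j → toℕ i <ᵇ toℕ j)))
  (trans (count2-cong {count U} (enum-< U)) (count2-< (count U)))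

maxDeg-induced : ∀ {G r} U → MaxDegLe G r → MaxDegLe (induced G U) r
maxDeg-induced {G} U d v = ≤-trans (≤-reflexive (count-enum U (adj G (enum U v))))
  (≤-trans (count-mono {p = λ i → U i ∧ adj G (enum U v) i} (λ i → ∧-conicalʳ (U i) _)) (d (enum U v)))

-- Restricting `cons b p` along `enum` gives `cons b` of the restriction only pointwise, so without
-- function extensionality the target predicate of `cs-enum` must respect pointwise equality.
Extensional : ∀ {k} → (Subset k → Bool) → Set
Extensional Q = ∀ p q → (∀ i → p i ≡ q i) → Q p ≡ Q q

cons-cong : ∀ {k} b {p q : Subset k} → (∀ i → p i ≡ q i) → ∀ i → cons b p i ≡ cons b q i
cons-cong b e zero    = refl
cons-cong b e (suc i) = e i

cs-enum : ∀ {k} (U : Subset k) (P : Subset k → Bool) (Q : Subset (count U) → Bool) → Extensional Q →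
  (∀ p → P p ≡ true → (p ⊆ U) × (Q (p ∘ enum U) ≡ true)) → countSubsets P ≤ countSubsets Q
cs-enum {zero} U P Q ext h = ind-mono λ e → trans (ext _ _ (λ ())) (proj₂ (h (λ ()) e))
cs-enum {suc k} U P Q ext h with U zero in eq
... | true = +-mono-≤
  (cs-enum (U ∘ suc) (λ p → P (cons true p)) (λ q → Q (cons true q)) (λ p q e → ext _ _ (cons-cong true e)) (step′ true))
  (cs-enum (U ∘ suc) (λ p → P (cons false p)) (λ q → Q (cons false q)) (λ p q e → ext _ _ (cons-cong false e)) (step′ false))
  where
  step′ : ∀ b p → P (cons b p) ≡ true → (p ⊆ (U ∘ suc)) × (Q (cons b (p ∘ enum (U ∘ suc))) ≡ true)
  step′ b p e with h (cons b p) e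
  ... | sub , q = (λ i → sub (suc i)) , trans (ext _ _ λ { zero → refl ; (suc i) → refl }) q
... | false = ≤-trans (≤-reflexive (cong (_+ countSubsets (λ p → P (cons false p))) (cs-empty (λ p → P (cons true p)) none)))
  (cs-enum (U ∘ suc) (λ p → P (cons false p)) Q ext (λ p e → (λ i → proj₁ (h (cons false p) e) (suc i)) , proj₂ (h (cons false p) e)))
  where
  none : ∀ p → P (cons true p) ≡ false
  none p with P (cons true p) in e
  ... | false = refl
  ... | true  = true≢false (proj₁ (h (cons true p) e) zero refl) eq

cliques-induced : ∀ t G U →
  countSubsets (λ p → ((count p ≡ᵇ t) ∧ isCliqueᵇ G p) ∧ subᵇ p U) ≤ cliques t (induced G U)
cliques-induced t G U = cs-enum U _ (λ q → (count q ≡ᵇ t) ∧ isCliqueᵇ (induced G U) q) ext restrict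
  where
  ext : Extensional (λ q → (count q ≡ᵇ t) ∧ isCliqueᵇ (induced G U) q)
  ext p q e = cong₂ _∧_ (cong (_≡ᵇ t) (count-cong e))
    (allFin-cong λ i → allFin-cong λ j → cong (_∨ adj (induced G U) i j) (cong₂ (λ x y → not (x ∧ y ∧ not ⌊ i ≟ j ⌋)) (e i) (e j)))
  restrict : ∀ p → ((count p ≡ᵇ t) ∧ isCliqueᵇ G p) ∧ subᵇ p U ≡ true →
             (p ⊆ U) × ((count (p ∘ enum U) ≡ᵇ t) ∧ isCliqueᵇ (induced G U) (p ∘ enum U) ≡ true)
  restrict p h = p⊆U , ∧-true
    (trans (cong (_≡ᵇ t) (trans (count-enum U p) (count-cong absorb))) (∧-conicalˡ _ _ pc))
    (clique-intro (induced G U) {p ∘ enum U} λ i j pi pj i≢j →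
      clique-elim G {p} (∧-conicalʳ (count p ≡ᵇ t) _ pc) (enum U i) (enum U j) pi pj (λ e → i≢j (enum-injective U e)))
    where
    pc : (count p ≡ᵇ t) ∧ isCliqueᵇ G p ≡ true
    pc = ∧-conicalˡ _ _ h
    p⊆U : p ⊆ U
    p⊆U i = ⇒-elim (allFin-elim _ (∧-conicalʳ ((count p ≡ᵇ t) ∧ isCliqueᵇ G p) _ h) i)
    absorb : ∀ i → U i ∧ p i ≡ p i
    absorb i = bool-ext (∧-conicalʳ (U i) _) (λ e → ∧-true (p⊆U i e) e)

-- The folding at a tight clique

ind-<ᵇ-trichotomy : ∀ {k} {i j : Fin k} → i ≢ j → 1 ≡ ind (toℕ i <ᵇ toℕ j) + ind (toℕ j <ᵇ toℕ i)
ind-<ᵇ-trichotomy {i = i} {j} i≢j with <-cmp (toℕ i) (toℕ j)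
... | tri< lt _ _ rewrite <ᵇ-complete lt | ≮ᵇ-complete (<⇒≤ lt) = refl
... | tri≈ _ e _ = contradiction (toℕ-injective e) i≢j
... | tri> _ _ gt rewrite <ᵇ-complete gt | ≮ᵇ-complete (<⇒≤ gt) = refl

module Folding {G : Graph} {r : ℕ} (deg : MaxDegLe G r) {T : Subset (n G)} (tight : Tight G r T) where

  -- `Rest G T v` is `not (W v)` by definition, so splitting along `W` separates `W` from `Rest`
  -- with no conversion.
  W : Subset (n G)
  W v = T v ∨ S G T v

  lt : Fin (n G) → Fin (n G) → Bool
  lt i j = toℕ i <ᵇ toℕ j

  S-adj : ∀ {u v} → T u ≡ true → S G T v ≡ true → adj G u v ≡ true
  S-adj {u} Tu Sv = ⇒-elim (allFin-elim _ Sv u) Tu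

  S⇒W : ∀ {i} → S G T i ≡ true → W i ≡ true
  S⇒W {i} Si = trans (cong (T i ∨_) Si) (∨-zeroʳ _)

  S⇒∉T : ∀ {v} → S G T v ≡ true → T v ≡ false
  S⇒∉T {v} Sv with T v in e
  ... | false = refl
  ... | true  = true≢false (S-adj e Sv) (irrefl G v)

  T-adj-W : ∀ {u v} → T u ≡ true → W v ≡ true → u ≢ v → adj G u v ≡ true
  T-adj-W {u} {v} Tu Wv u≢v with ∨-cases (T v) Wv
  ... | inj₁ Tv = proj₁ tight u v Tu Tv u≢v
  ... | inj₂ Sv = S-adj Tu Sv

  count-W : count W ≡ suc r
  count-W = trans (count-+ {p = W} {S G T} {T} disjoint) (proj₂ (proj₂ tight))
    where
    disjoint : ∀ i → ind (W i) ≡ ind (S G T i) + ind (T i)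
    disjoint i with S G T i in s
    ... | true rewrite S⇒∉T s = refl
    ... | false with T i
    ...   | true  = refl
    ...   | false = refl

  -- The closed neighbourhood of a vertex of T has at most r + 1 elements, and W already fills it.
  T-Rest-nonadj : ∀ {u v} → T u ≡ true → Rest G T v ≡ true → adj G u v ≡ false
  T-Rest-nonadj {u} {v} Tu Rv with adj G u v in e
  ... | false = refl
  ... | true  = contradiction tooMany (<-irrefl refl)
    where
    open ≤-Reasoning
    N[u] : Subset (n G)
    N[u] i = adj G u i ∨ ⌊ i ≟ u ⌋
    W⊆N : W ⊆ N[u]
    W⊆N i Wi with i ≟ u
    ... | yes _ = ∨-zeroʳ _
    ... | no i≢u rewrite T-adj-W Tu Wi (λ eq → i≢u (≡-sym eq)) = refl
    v∈N : ∀ i → ⌊ i ≟ v ⌋ ≡ true → N[u] i ≡ true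
    v∈N i h rewrite ≟-sound i v h | e = refl
    v∉W : ∀ i → ⌊ i ≟ v ⌋ ≡ true → W i ≡ false
    v∉W i h rewrite ≟-sound i v h = not-true⇒false Rv
    tooMany : suc r < suc r
    tooMany = begin
      2 + r                                     ≡⟨ +-comm 1 (suc r) ⟩
      suc r + 1                                 ≡⟨ cong₂ _+_ count-W (count-singleton v) ⟨
      count W + count (λ i → ⌊ i ≟ v ⌋)         ≤⟨ count-disjoint W⊆N v∈N v∉W ⟩
      count N[u]                                ≤⟨ count-∪ N[u] (adj G u) _ (λ i → ∨-cases (adj G u i)) ⟩
      degree G u + count (λ i → ⌊ i ≟ u ⌋)      ≤⟨ +-mono-≤ (deg u) (≤-reflexive (count-singleton u)) ⟩
      r + 1                                     ≡⟨ +-comm r 1 ⟩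
      suc r                                     ∎

  bEdge rEdge : Fin (n G) → Fin (n G) → Bool
  bEdge u v = S G T u ∧ Rest G T v ∧ adj G u v
  rEdge i j = lt i j ∧ S G T i ∧ S G T j ∧ not (adj G i j)

  -- By `T-Rest-nonadj` the end in `W` cannot lie in `T`, so B consists of all edges that leave `W`.
  W-Rest⇒bEdge : ∀ {u v} → W u ≡ true → Rest G T v ≡ true → adj G u v ≡ true → bEdge u v ≡ true
  W-Rest⇒bEdge {u} {v} Wu Rv a with ∨-cases (T u) Wu
  ... | inj₁ Tu = true≢false a (T-Rest-nonadj Tu Rv)
  ... | inj₂ Su = ∧-true Su (∧-true Rv a)

  eW : ℕ
  eW = count2 (λ i j → W i ∧ W j ∧ lt i j ∧ adj G i j)

  -- Vertices of `T` are adjacent to everything else in `W`, so the nonadjacent pairs of `W` all lie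
  -- in `S`: R accounts for all the pairs missing from `G[W]`.
  eW+eR : eW + eR G T ≡ suc r C 2
  eW+eR = begin
    eW + eR G T                                                              ≡⟨ cong (eW +_) (count2-cong missing) ⟩
    eW + count2 (λ i j → W i ∧ W j ∧ lt i j ∧ not (adj G i j))               ≡⟨ count2-+ (λ i j → pointwise (W i) (W j) (lt i j) (adj G i j)) ⟨
    count2 (λ i j → W i ∧ W j ∧ lt i j)                                      ≡⟨ count2-pairs W ⟩
    count W C 2                                                              ≡⟨ cong (_C 2) count-W ⟩
    suc r C 2                                                                ∎
    where
    open ≡-Reasoning
    pointwise : ∀ w x l a → ind (w ∧ x ∧ l) ≡ ind (w ∧ x ∧ l ∧ a) + ind (w ∧ x ∧ l ∧ not a)
    pointwise false _     _     _     = refl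
    pointwise true  false _     _     = refl
    pointwise true  true  false _     = refl
    pointwise true  true  true  false = refl
    pointwise true  true  true  true  = refl
    lt⇒≢ : ∀ {i j} → lt i j ≡ true → i ≢ j
    lt⇒≢ {i} l refl = <-irrefl refl (<ᵇ-sound (toℕ i) (toℕ i) l)
    nonadj⇒S : ∀ {i j} → W i ≡ true → W j ≡ true → i ≢ j → adj G i j ≡ false → S G T i ≡ true
    nonadj⇒S {i} Wi Wj i≢j na with ∨-cases (T i) Wi
    ... | inj₁ Ti = true≢false (T-adj-W Ti Wj i≢j) na
    ... | inj₂ Si = Si
    missing : ∀ i j → rEdge i j ≡ W i ∧ W j ∧ lt i j ∧ not (adj G i j)
    missing i j = bool-ext to from
      where
      to : rEdge i j ≡ true → W i ∧ W j ∧ lt i j ∧ not (adj G i j) ≡ true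
      to h with ∧-conicalˡ (lt i j) _ h | ∧-conicalʳ (lt i j) _ h
      ... | l | h′ with ∧-conicalˡ (S G T i) _ h′ | ∧-conicalʳ (S G T i) _ h′
      ... | Si | h″ = ∧-true (S⇒W Si) (∧-true (S⇒W (∧-conicalˡ (S G T j) _ h″)) (∧-true l (∧-conicalʳ (S G T j) _ h″)))
      from : W i ∧ W j ∧ lt i j ∧ not (adj G i j) ≡ true → rEdge i j ≡ true
      from h with ∧-conicalˡ (W i) _ h | ∧-conicalʳ (W i) _ h
      ... | Wi | h′ with ∧-conicalˡ (W j) _ h′ | ∧-conicalʳ (W j) _ h′
      ... | Wj | h″ with ∧-conicalˡ (lt i j) _ h″ | ∧-conicalʳ (lt i j) _ h″
      ... | l | na = ∧-true l (∧-true (nonadj⇒S Wi Wj (lt⇒≢ l) (not-true⇒false na))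
        (∧-true (nonadj⇒S Wj Wi (λ e → lt⇒≢ l (≡-sym e)) (trans (sym G j i) (not-true⇒false na))) na))

  edges-split : edges G ≡ edges (induced G (Rest G T)) + (eW + eB G T)
  edges-split = begin
    edges G
      ≡⟨ count2-+ (λ i j → byFirst (W i) (e i j)) ⟩
    count2 (λ i j → not (W i) ∧ e i j) + count2 (λ i j → W i ∧ e i j)
      ≡⟨ cong₂ _+_ (count2-+ (λ i j → bySecond (not (W i)) (W j) (e i j))) (count2-+ (λ i j → bySecond (W i) (W j) (e i j))) ⟩
    (eRest + count2 (λ i j → not (W i) ∧ W j ∧ e i j)) + (count2 (λ i j → W i ∧ not (W j) ∧ e i j) + eW)
      ≡⟨ +-assoc eRest _ _ ⟩
    eRest + (count2 (λ i j → not (W i) ∧ W j ∧ e i j) + (count2 (λ i j → W i ∧ not (W j) ∧ e i j) + eW))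
      ≡⟨ cong (eRest +_) (+-assoc (count2 (λ i j → not (W i) ∧ W j ∧ e i j)) _ _) ⟨
    eRest + (count2 (λ i j → not (W i) ∧ W j ∧ e i j) + count2 (λ i j → W i ∧ not (W j) ∧ e i j) + eW)
      ≡⟨ cong₂ (λ x y → x + (y + eW)) (≡-sym (edges-induced G (Rest G T))) mixed ⟩
    edges (induced G (Rest G T)) + (eB G T + eW)
      ≡⟨ cong (edges (induced G (Rest G T)) +_) (+-comm (eB G T) eW) ⟩
    edges (induced G (Rest G T)) + (eW + eB G T) ∎
    where
    open ≡-Reasoning
    e : Fin (n G) → Fin (n G) → Bool
    e i j = lt i j ∧ adj G i j
    eRest : ℕ
    eRest = count2 (λ i j → not (W i) ∧ not (W j) ∧ e i j)
    byFirst : ∀ w x → ind x ≡ ind (not w ∧ x) + ind (w ∧ x)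
    byFirst true  x = refl
    byFirst false x = ≡-sym (+-identityʳ _)
    bySecond : ∀ u w x → ind (u ∧ x) ≡ ind (u ∧ not w ∧ x) + ind (u ∧ w ∧ x)
    bySecond false w x = refl
    bySecond true  w x = byFirst w x
    -- `eB` orients an edge from `S` to `Rest`, `edges` from the smaller to the larger index. Each
    -- edge of B is thus found in exactly one of the two mixed counts, one of which gets transposed.
    orient : ∀ i j → ind (bEdge i j) ≡ ind (W i ∧ not (W j) ∧ lt j i ∧ adj G i j) + ind (W i ∧ not (W j) ∧ e i j)
    orient i j = trans (cong ind (bool-ext to from)) (cases (W i) (W j) (adj G i j) (lt i j) (lt j i) tri)
      where
      to : bEdge i j ≡ true → W i ∧ not (W j) ∧ adj G i j ≡ true
      to h = ∧-true (S⇒W (∧-conicalˡ (S G T i) _ h)) (∧-conicalʳ (S G T i) _ h)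
      from : W i ∧ not (W j) ∧ adj G i j ≡ true → bEdge i j ≡ true
      from h = W-Rest⇒bEdge (∧-conicalˡ (W i) _ h)
        (∧-conicalˡ (not (W j)) _ (∧-conicalʳ (W i) _ h)) (∧-conicalʳ (not (W j)) _ (∧-conicalʳ (W i) _ h))
      tri : W i ≡ true → W j ≡ false → 1 ≡ ind (lt i j) + ind (lt j i)
      tri Wi Wj = ind-<ᵇ-trichotomy {i = i} {j} λ { refl → true≢false Wi Wj }
      cases : ∀ w x a l m → (w ≡ true → x ≡ false → 1 ≡ ind l + ind m) →
              ind (w ∧ not x ∧ a) ≡ ind (w ∧ not x ∧ m ∧ a) + ind (w ∧ not x ∧ l ∧ a)
      cases false _     _     _     _     _ = refl
      cases true  true  _     _     _     _ = refl
      cases true  false false false false _ = refl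
      cases true  false false false true  _ = refl
      cases true  false false true  false _ = refl
      cases true  false false true  true  _ = refl
      cases true  false true  false false h = h refl refl
      cases true  false true  false true  _ = refl
      cases true  false true  true  false _ = refl
      cases true  false true  true  true  h with () ← h refl refl
    swap : ∀ i j → not (W j) ∧ W i ∧ e j i ≡ W i ∧ not (W j) ∧ lt j i ∧ adj G i j
    swap i j rewrite sym G j i with W i | W j
    ... | true  | true  = refl
    ... | true  | false = refl
    ... | false | true  = refl
    ... | false | false = refl
    mixed : count2 (λ i j → not (W i) ∧ W j ∧ e i j) + count2 (λ i j → W i ∧ not (W j) ∧ e i j) ≡ eB G T
    mixed = begin
      count2 (λ i j → not (W i) ∧ W j ∧ e i j) + count2 (λ i j → W i ∧ not (W j) ∧ e i j)
        ≡⟨ cong (_+ count2 (λ i j → W i ∧ not (W j) ∧ e i j)) (trans (count2-transpose (λ i j → not (W i) ∧ W j ∧ e i j)) (count2-cong swap)) ⟩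
      count2 (λ i j → W i ∧ not (W j) ∧ lt j i ∧ adj G i j) + count2 (λ i j → W i ∧ not (W j) ∧ e i j)
        ≡⟨ count2-+ orient ⟨
      eB G T ∎

  N : ℕ
  N = (suc r C 2) ∸ eR G T + eB G T

  -- The truncated subtraction in `N` is exact, since `eR` is a summand of `suc r C 2` by `eW+eR`.
  colexSize : N ≡ eW + eB G T
  colexSize = cong (_+ eB G T) (trans (cong (_∸ eR G T) (≡-sym eW+eR)) (m+n∸n≡m eW (eR G T)))

  edges-fold : edges (fold G r T) ≡ edges G
  edges-fold = begin
    edges (fold G r T)                                         ≡⟨ edges-⊕ (induced G (Rest G T)) (colex N) ⟩
    edges (induced G (Rest G T)) + edges (colex N)             ≡⟨ cong (edges (induced G (Rest G T)) +_) (trans (edges-colex N) colexSize) ⟩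
    edges (induced G (Rest G T)) + (eW + eB G T)               ≡⟨ edges-split ⟨
    edges G                                                    ∎
    where open ≡-Reasoning

  maxDeg-fold : eB G T ≤ eR G T → MaxDegLe (fold G r T) r
  maxDeg-fold b≤q = maxDeg-⊕ (induced G (Rest G T)) (colex N) (maxDeg-induced {G} (Rest G T) deg) (maxDeg-colex {N} (begin
    N                             ≡⟨ colexSize ⟩
    eW + eB G T                   ≤⟨ +-monoʳ-≤ eW b≤q ⟩
    eW + eR G T                   ≡⟨ eW+eR ⟩
    suc r C 2                     ∎))
    where open ≤-Reasoning

  -- A clique contains no edge of R, hence is among the sets that `avoids-bound` counts for the list
  -- of these edges.
  cliques-W : ∀ s x → eR G T + x ≡ r →
    countSubsets (λ p → ((count p ≡ᵇ 2 + s) ∧ isCliqueᵇ G p) ∧ subᵇ p W) ≤ r C (2 + s) + x C (1 + s)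
  cliques-W s x len = ≤-trans (cs-mono sound)
    (avoids-bound W count-W (pairs rEdge) (pairs-unique rEdge) (All.map inW (pairs-sound rEdge)) s x
      (trans (cong (_+ x) (length-pairs rEdge)) len))
    where
    inW : ∀ {g} → rEdge (proj₁ g) (proj₂ g) ≡ true → InW W count-W g
    inW {i , j} h = <ᵇ-sound _ _ (∧-conicalˡ (lt i j) _ h)
      , S⇒W (∧-conicalˡ (S G T i) _ h′)
      , S⇒W (∧-conicalˡ (S G T j) _ (∧-conicalʳ (S G T i) _ h′))
      where
      h′ = ∧-conicalʳ (lt i j) _ h
    avoid : ∀ p → IsClique G p → ∀ L → All (λ (i , j) → rEdge i j ≡ true) L → avoids L p ≡ true
    avoid p c [] [] = refl
    avoid p c ((i , j) ∷ L) (h ∷ hs) = ∧-true notBoth (avoid p c L hs)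
      where
      nonadj : adj G i j ≡ false
      nonadj = not-true⇒false (∧-conicalʳ (S G T j) _ (∧-conicalʳ (S G T i) _ (∧-conicalʳ (lt i j) _ h)))
      i≢j : i ≢ j
      i≢j refl = <-irrefl refl (<ᵇ-sound (toℕ i) (toℕ i) (∧-conicalˡ (lt i i) _ h))
      notBoth : not (p i ∧ p j) ≡ true
      notBoth with p i in pi | p j in pj
      ... | false | _     = refl
      ... | true  | false = refl
      ... | true  | true  = true≢false (c i j pi pj i≢j) nonadj
    sound : ∀ p → ((count p ≡ᵇ 2 + s) ∧ isCliqueᵇ G p) ∧ subᵇ p W ≡ true →
            (count p ≡ᵇ 2 + s) ∧ subᵇ p W ∧ avoids (pairs rEdge) p ≡ true
    sound p h with ∧-conicalˡ ((count p ≡ᵇ 2 + s) ∧ isCliqueᵇ G p) _ h | ∧-conicalʳ ((count p ≡ᵇ 2 + s) ∧ isCliqueᵇ G p) _ h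
    ... | pc | sub = ∧-true (∧-conicalˡ (count p ≡ᵇ 2 + s) _ pc) (∧-true sub
      (avoid p (clique-elim G {p} (∧-conicalʳ (count p ≡ᵇ 2 + s) _ pc)) (pairs rEdge) (pairs-sound rEdge)))

  sub-false : ∀ {p U : Subset (n G)} → subᵇ p U ≡ false → ∃[ i ] (p i ≡ true) × (U i ≡ false)
  sub-false {p} {U} h with allFin-false _ h
  ... | i , e with p i in pi | U i in ui
  ...   | true | false = i , pi , ui

  -- A clique inside neither `Rest` nor `W` has a vertex in each, and any such two of its vertices
  -- form an edge of B.
  cliques-crossing : ∀ s →
    countSubsets (λ p → (((count p ≡ᵇ 2 + s) ∧ isCliqueᵇ G p) ∧ not (subᵇ p (Rest G T))) ∧ not (subᵇ p W))
      ≤ eB G T C (1 + s)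
  cliques-crossing s = ≤-trans
    (crossing-bound bEdge (pairs bEdge) (All.map (λ {g} → distinct {g}) (pairs-sound bEdge)) s _ crossing)
    (≤-reflexive (cong (_C (1 + s)) (length-pairs bEdge)))
    where
    bEdge-S : ∀ {u v} → bEdge u v ≡ true → S G T u ≡ true
    bEdge-S {u} = ∧-conicalˡ (S G T u) _
    bEdge-Rest : ∀ {u v} → bEdge u v ≡ true → Rest G T v ≡ true
    bEdge-Rest {u} {v} h = ∧-conicalˡ (Rest G T v) _ (∧-conicalʳ (S G T u) _ h)
    W≢Rest : ∀ {u v} → W u ≡ true → Rest G T v ≡ true → u ≢ v
    W≢Rest Wu Rv refl = true≢false Wu (not-true⇒false Rv)
    distinct : ∀ {g : Fin (n G) × Fin (n G)} → bEdge (proj₁ g) (proj₂ g) ≡ true → proj₁ g ≢ proj₂ g × bEdge (proj₁ g) (proj₂ g) ≡ true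
    distinct {u , v} h = W≢Rest (S⇒W (bEdge-S {u} {v} h)) (bEdge-Rest {u} {v} h) , h
    crossing : ∀ p → (((count p ≡ᵇ 2 + s) ∧ isCliqueᵇ G p) ∧ not (subᵇ p (Rest G T))) ∧ not (subᵇ p W) ≡ true →
               count p ≡ 2 + s × Crossing bEdge (pairs bEdge) p
    crossing p h = ≡ᵇ-sound _ _ (∧-conicalˡ (count p ≡ᵇ 2 + s) _ pc) , record
      { edge    = edge (sub-false {p} {Rest G T} (not-true⇒false (∧-conicalʳ ((count p ≡ᵇ 2 + s) ∧ isCliqueᵇ G p) _ h′)))
                       (sub-false {p} {W} (not-true⇒false (∧-conicalʳ (((count p ≡ᵇ 2 + s) ∧ isCliqueᵇ G p) ∧ not (subᵇ p (Rest G T))) _ h)))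
      ; listed  = λ _ _ → pairs-complete bEdge
      ; spanned = λ {u} {v} {w} pu pv f pw → spanned u v w pu pv f pw
      }
      where
      h′ : ((count p ≡ᵇ 2 + s) ∧ isCliqueᵇ G p) ∧ not (subᵇ p (Rest G T)) ≡ true
      h′ = ∧-conicalˡ _ (not (subᵇ p W)) h
      pc : (count p ≡ᵇ 2 + s) ∧ isCliqueᵇ G p ≡ true
      pc = ∧-conicalˡ _ (not (subᵇ p (Rest G T))) h′
      clique : IsClique G p
      clique = clique-elim G {p} (∧-conicalʳ (count p ≡ᵇ 2 + s) _ pc)
      join : ∀ {u v} → p u ≡ true → p v ≡ true → W u ≡ true → Rest G T v ≡ true → bEdge u v ≡ true
      join {u} {v} pu pv Wu Rv = W-Rest⇒bEdge Wu Rv (clique u v pu pv (W≢Rest Wu Rv))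
      edge : (∃[ u ] (p u ≡ true) × (Rest G T u ≡ false)) → (∃[ v ] (p v ≡ true) × (W v ≡ false)) →
             ∃[ u ] ∃[ v ] (p u ≡ true) × (p v ≡ true) × (bEdge u v ≡ true)
      edge (u , pu , Ru) (v , pv , Wv) = u , v , pu , pv , join pu pv (not-injective Ru) (cong not Wv)
      -- A further vertex of the clique in `W` is joined to the end `v` in `Rest`; one outside `W`
      -- is joined to the end `u` in `S`.
      spanned : ∀ u v w → p u ≡ true → p v ≡ true → bEdge u v ≡ true → p w ≡ true → (bEdge w v ≡ true) ⊎ (bEdge u w ≡ true)
      spanned u v w pu pv f pw with ≡true-or-false (W w)
      ... | inj₁ Ww = inj₁ (join pw pv Ww (bEdge-Rest {u} {v} f))
      ... | inj₂ Ww = inj₂ (join pu pw (S⇒W (bEdge-S {u} {v} f)) (cong not Ww))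

  cliques-fold : eB G T ≤ eR G T → eR G T ≤ r → ∀ s → cliques (2 + s) G ≤ cliques (2 + s) (fold G r T)
  cliques-fold b≤q q≤r s = begin
    cliques (2 + s) G
      ≡⟨ cs-split K (λ p → subᵇ p (Rest G T)) ⟩
    countSubsets (λ p → K p ∧ subᵇ p (Rest G T)) + countSubsets K′
      ≤⟨ +-mono-≤ (cliques-induced (2 + s) G (Rest G T)) meetsW ⟩
    cliques (2 + s) (induced G (Rest G T)) + cliques (2 + s) (colex (r C 2 + (x + eB G T)))
      ≡⟨ cong (λ k → cliques (2 + s) (induced G (Rest G T)) + cliques (2 + s) (colex k)) size ⟨
    cliques (2 + s) (induced G (Rest G T)) + cliques (2 + s) (colex N)
      ≤⟨ cliques-⊕ (1 + s) (induced G (Rest G T)) (colex N) ⟩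
    cliques (2 + s) (fold G r T) ∎
    where
    open ≤-Reasoning
    x : ℕ
    x = r ∸ eR G T
    K K′ : Subset (n G) → Bool
    K p = (count p ≡ᵇ 2 + s) ∧ isCliqueᵇ G p
    K′ p = K p ∧ not (subᵇ p (Rest G T))
    size : N ≡ r C 2 + (x + eB G T)
    -- `suc r C 2` is `r C 2 + r`, and `eR G T ≤ r` lets the subtraction act on the summand `r`
    -- alone.
    size = trans (cong (_+ eB G T) (trans (cong (_∸ eR G T) (C2-suc r)) (+-∸-assoc (r C 2) q≤r))) (+-assoc (r C 2) x _)
    -- This keeps the last vertex of the colex graph from needing more than the `r` neighbours
    -- before it.
    x+b≤r : x + eB G T ≤ r
    x+b≤r = ≤-trans (+-monoʳ-≤ x b≤q) (≤-reflexive (m∸n+n≡m q≤r))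
    meetsW : countSubsets K′ ≤ cliques (2 + s) (colex (r C 2 + (x + eB G T)))
    meetsW = begin
      countSubsets K′
        ≡⟨ cs-split K′ (λ p → subᵇ p W) ⟩
      countSubsets (λ p → K′ p ∧ subᵇ p W) + countSubsets (λ p → K′ p ∧ not (subᵇ p W))
        ≤⟨ +-mono-≤ (≤-trans (cs-mono weaken) (cliques-W s x (m+[n∸m]≡n q≤r))) (cliques-crossing s) ⟩
      r C (2 + s) + x C (1 + s) + eB G T C (1 + s)
        ≡⟨ +-assoc (r C (2 + s)) _ _ ⟩
      r C (2 + s) + (x C (1 + s) + eB G T C (1 + s))
        ≤⟨ +-monoʳ-≤ (r C (2 + s)) (C-superadditive x (eB G T) s) ⟩
      r C (2 + s) + (x + eB G T) C (1 + s)
        ≤⟨ cliques-colex r (x + eB G T) s x+b≤r ⟩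
      cliques (2 + s) (colex (r C 2 + (x + eB G T))) ∎
      where
      weaken : ∀ p → K′ p ∧ subᵇ p W ≡ true → K p ∧ subᵇ p W ≡ true
      weaken p h = ∧-true (∧-conicalˡ (K p) _ (∧-conicalˡ (K′ p) _ h)) (∧-conicalʳ (K′ p) _ h)

theorem3p5 : (m r : ℕ) → 1 ≤ r → (G : Graph) → Connected G → edges G ≡ m →
    MaxDegLe G r → (T : Subset (n G)) → Cluster G r T →
    eB G T < eR G T → eR G T ≤ r →
    (edges (fold G r T) ≡ m) × MaxDegLe (fold G r T) r ×
    (∀ t → 2 ≤ t → cliques t G ≤ cliques t (fold G r T))
theorem3p5 m r _ G _ e≡m deg T (tight , _) b<q q≤r =
  trans edges-fold e≡m , maxDeg-fold (<⇒≤ b<q) , λ { _ (s≤s (s≤s {n = s} _)) → cliques-fold (<⇒≤ b<q) q≤r s }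
  where open Folding {G} {r} deg {T} tight
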